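{- Let $p$ be a prime, let $R := \mathbf{Z}/p^{k} \mathbf{Z}$ for some $k \geq 1$, and let $A \subset R$ be a non-empty finite set such that $|A+A| \leq K|A|$ and $|A \cdot A| \leq K|A|$ for some $K \geq 1$. Then one of the following holds: (i) $A \subset p \cdot R + \mathbf{O}( K^{O(1)} )$; (ii) $|A| \gg K^{ -O(1)} |R|$.
   Context: For subsets $A,B$ of a ring: $A+B := \{a+b : a\in A, b\in B\}$, $A\cdot B := \{ab : a\in A, b\in B\}$; $p\cdot R := \{pr : r\in R\}$. $|A|$ denotes the cardinality of a finite set $A$. $X \gg Y$ means $Y \leq CX$ for some absolute constant $C$; $O(1)$ denotes a quantity bounded by an absolute constant. $\mathbf{O}(N)$ denotes an unspecified finite non-empty subset of $R$ of cardinality $O(N)$; thus (i) means that there is a finite non-empty set $X \subset R$ with $|X| \leq C K^{C}$, $C$ an absolute constant, such that $A \subset p\cdot R + X$. All implied constants are absolute (independent of $p$, $k$, $A$, $K$). -}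

module Defs where

open import Algebra.Definitions.RawSemiring using () renaming (_^_ to power)
open import Data.Fin using (Fin; toℕ)
open import Data.Fin.Properties using (_≟_; any?; nonZeroIndex)
open import Data.Fin.Subset using (Subset)
open import Data.Fin.Subset.Properties using (_∈?_)
open import Data.Integer using (+_)
open import Data.Nat as ℕ using (ℕ)
open import Data.Nat.DivMod using (_mod_)
open import Data.Rational as ℚ using (ℚ; 1ℚ; _/_; 1/_)
import Data.Rational.Properties as ℚ
open import Data.Vec using (tabulate)
open import Relation.Nullary using (does)
open import Relation.Nullary.Decidable using (_×-dec_; toWitness)

-- The ring ℤ/nℤ, with each class represented by its least non-negative
-- residue.  An element of Fin n already witnesses that n is non-zero.

ℤ/ : ℕ → Set
ℤ/ = Fin

infixl 6 _+ᴿ_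
infixl 7 _*ᴿ_ _·ᴿ_

_+ᴿ_ : ∀ {n} → ℤ/ n → ℤ/ n → ℤ/ n
_+ᴿ_ {n} a b = ((toℕ a ℕ.+ toℕ b) mod n) {{nonZeroIndex a}}

_*ᴿ_ : ∀ {n} → ℤ/ n → ℤ/ n → ℤ/ n
_*ᴿ_ {n} a b = ((toℕ a ℕ.* toℕ b) mod n) {{nonZeroIndex a}}

-- Multiplication by the image of the natural number m in the ring.

_·ᴿ_ : ∀ {n} → ℕ → ℤ/ n → ℤ/ n
_·ᴿ_ {n} m r = ((m ℕ.* toℕ r) mod n) {{nonZeroIndex r}}

-- The set { f a b : a ∈ A, b ∈ B }.

image₂ : ∀ {n} → (ℤ/ n → ℤ/ n → ℤ/ n) → Subset n → Subset n → Subset n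
image₂ f A B = tabulate λ c →
  does (any? λ a → any? λ b → (a ∈? A) ×-dec (b ∈? B) ×-dec (f a b ≟ c))

infixl 6 _+ˢ_
infixl 7 _*ˢ_

_+ˢ_ : ∀ {n} → Subset n → Subset n → Subset n
_+ˢ_ = image₂ _+ᴿ_

_*ˢ_ : ∀ {n} → Subset n → Subset n → Subset n
_*ˢ_ = image₂ _*ᴿ_

-- The set m · R = { m r : r ∈ R }, where R = ℤ/nℤ.

_·R : ∀ {n} → ℕ → Subset n
m ·R = tabulate λ c → does (any? λ r → m ·ᴿ r ≟ c)

fromℕ : ℕ → ℚ
fromℕ n = + n / 1

infixr 8 _^ℚ_

_^ℚ_ : ℚ → ℕ → ℚ
_^ℚ_ = power ℚ.+-*-rawSemiring

inverse : (K : ℚ) → 1ℚ ℚ.≤ K → ℚ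
inverse K 1≤K = (1/ K) {{ℚ.>-nonZero (ℚ.<-≤-trans (toWitness {a? = ℚ.0ℚ ℚ.<? 1ℚ} _) 1≤K)}}

{-# OPTIONS --safe #-}

-- Write L for a natural number comparable to K, and let π be reduction mod p.
-- Call ξ good if |A + ξA| ≤ L^O(1) |A|.  Unless A meets few residue classes,
-- at least half of A consists of units.  Double counting the incidences
-- v ∈ aA then gives a unit b ∈ A and a large B ⊆ A with
-- |aA ∩ bA| ≥ |A| / L^O(1) for a ∈ B.  By Ruzsa covering, ±aA lies in few
-- translates of bA − bA, and the popular differences of bA keep iterated sums
-- of bA − bA small, so 1 + q is good for every quotient
-- q = (a₁ − a₂)/(a₃ − a₄) with aᵢ ∈ B and π a₃ ≢ π a₄ (which makes the
-- denominator a unit).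
--
-- If 1 + q is not a quotient for some quotient q, then (b , t) ↦ b + (1 + q) t
-- is injective on B × T for a transversal T of B mod p, so T is small and A
-- meets few residue classes.  Otherwise, since 1 generates the additive group,
-- every element of R is a quotient, hence every element is good; but two pairs
-- (a , t) with t in a transversal collide under a + ξ t for at most one ξ,
-- which forces |R| ≤ L^O(1) |A|.
module Submission where

open import Algebra.Bundles using (CommutativeRing; RawRing)
open import Algebra.Core using (Op₁; Op₂)
import Algebra.Properties.AbelianGroup
import Algebra.Properties.CommutativeSemigroup
import Algebra.Properties.Ring
import Algebra.Properties.Semiring.Mult
import Algebra.Solver.Ring
open import Algebra.Solver.Ring.AlmostCommutativeRing using (fromCommutativeRing; _-Raw-AlmostCommutative⟶_; Induced-equivalence)
open import Algebra.Structures using (IsCommutativeRing)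
open import Data.Fin using (Fin; zero; suc; toℕ)
open import Data.Fin.Properties using (toℕ-injective; toℕ-fromℕ<; toℕ<n; suc-injective) renaming (_≟_ to _≟ᶠ_; any? to anyᶠ?)
open import Data.Fin.Subset as Subset using (Subset; inside; outside; ∣_∣; Nonempty; _⊆_)
open import Data.Fin.Subset.Properties using (∣⊤∣≡n) renaming (_∈?_ to _∈ˢ?_)
import Data.Integer.Properties as ℤ
open import Data.List using (List; []; _∷_; _++_; map; length; filter; cartesianProduct; cartesianProductWith; take)
import Data.List.Membership.DecPropositional as DecMembership
open import Data.List.Membership.Propositional using (_∈_; find; lose)
open import Data.List.Membership.Propositional.Properties using (∈-∃++; ∈-++⁺ˡ; ∈-++⁺ʳ; ∈-++⁻; ∈-map⁺; ∈-map⁻; ∈-filter⁺; ∈-filter⁻; ∈-cartesianProductWith⁺; ∈-cartesianProductWith⁻; ∈-cartesianProduct⁺; ∈-cartesianProduct⁻; ∈-allFin)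
open import Data.List.Properties using (length-++; length-map; filter-accept; filter-reject; length-take; take++drop≡id; length-tabulate)
open import Data.List.Relation.Unary.All as All using (All; []; _∷_)
open import Data.List.Relation.Unary.AllPairs as AllPairs using (AllPairs; []; _∷_)
import Data.List.Relation.Unary.AllPairs.Properties as AllPairs
open import Data.List.Relation.Unary.Any using (Any; here; there; any?)
open import Data.List.Relation.Unary.Unique.Propositional using (Unique)
open import Data.List.Relation.Unary.Unique.Propositional.Properties as Unique using (allFin⁺)
open import Data.Maybe using (just; nothing)
open import Data.Nat as ℕ using (ℕ; zero; suc; z≤n; s≤s)
open import Data.Nat.Coprimality using (Coprime; coprime-divisor; coprime-Bézout; 1-coprimeTo) renaming (sym to coprime-sym)
open import Data.Nat.DivMod using (_mod_; _%_; m%n<n; m<n⇒m%n≡m; m%n%n≡m%n; %-distribˡ-+; %-distribˡ-*; m∣n⇒o%n%m≡o%m; n%n≡0; m*n%n≡0; m≡m%n+[m/n]*n; m/n*n≤m)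
open import Data.Nat.Divisibility using (_∣_; divides; ∣-trans; m%n≡0⇒n∣m; n∣m⇒m%n≡0; ∣1⇒≡1; m∣m*n)
open import Data.Nat.GCD using (module Bézout)
open import Data.Nat.Primality using (Prime; prime⇒irreducible; prime⇒nonZero)
import Data.Nat.Properties as ℕ
open import Data.Nat.Solver using (module +-*-Solver)
open import Data.Nat.Tactic.RingSolver using (solve-∀)
open import Data.Product using (_×_; _,_; ∃-syntax; proj₁; proj₂)
open import Data.Product.Properties using (,-injective; ≡-dec)
open import Data.Sum as Sum using (_⊎_; inj₁; inj₂)
open import Data.Vec using (tabulate; []; _∷_; here; there)
open import Data.Vec.Properties using (lookup∘tabulate; lookup⇒[]=; []=⇒lookup)
open import Function using (_∘_; id)
open import Level using (0ℓ)
open import Relation.Binary.Definitions using (DecidableEquality; WeaklyDecidable)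
open import Relation.Binary.PropositionalEquality as ≡ using (_≡_; _≢_; refl; sym; trans; cong; cong₂; subst; module ≡-Reasoning; subst₂; isEquivalence)
open import Relation.Nullary using (¬_; Dec; yes; no; contradiction; does)
open import Relation.Nullary.Decidable using (¬?; _×-dec_; dec-true)
open import Relation.Unary using (Decidable)
open import Defs

-- Counting with lists

-- The obstacle is that the ring has zero divisors. Since `p` is prime, elements with different
-- residues differ by a unit, so collisions are counted over a transversal of residues: two distinct
-- members of it always have an invertible difference. The price is that the counting first bounds
-- the residues of `B`, and a separate step carries the bound back to `A`. All sumset estimates are
-- relative to the single dilate `bA`. `Growth` compares Y + Z + bA with Y + bA for every `Y`, so
-- that successive summands merely multiply the constants; this plays the part of Plünnecke's
-- inequality. The shift in `1 + q` matters: goodness is thereby known at the first element where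
-- the quotients cease to be closed under adding 1, which is exactly where the injective map has to
-- be bounded.

private
  variable
    X Y : Set

-- The partner of the head is deleted from `ys`; injectivity keeps every later element from being
-- matched to it. A relation instead of a function lets the partner be chosen existentially.
length-≤-by-relation : (ρ : X → Y → Set) {xs : List X} {ys : List Y} → Unique xs →
  (∀ {x} → x ∈ xs → ∃[ y ] y ∈ ys × ρ x y) →
  (∀ {x x' y} → x ∈ xs → x' ∈ xs → ρ x y → ρ x' y → x ≡ x') →
  length xs ℕ.≤ length ys
length-≤-by-relation ρ {[]} _ _ _ = z≤n
length-≤-by-relation ρ {x ∷ xs} (x≢ ∷ u) f inj
  with y , y∈ , xy ← f (here refl)
  with ys₁ , ys₂ , refl ← ∈-∃++ y∈ = ℕ.≤-trans
    (s≤s (length-≤-by-relation ρ {xs} {ys₁ ++ ys₂} u g (λ p q → inj (there p) (there q))))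
    (ℕ.≤-reflexive eq)
  where
  eq : suc (length (ys₁ ++ ys₂)) ≡ length (ys₁ ++ y ∷ ys₂)
  eq rewrite length-++ ys₁ {ys₂} | length-++ ys₁ {y ∷ ys₂} = sym (ℕ.+-suc _ _)
  g : ∀ {x'} → x' ∈ xs → ∃[ y' ] y' ∈ ys₁ ++ ys₂ × ρ x' y'
  g x'∈ with f (there x'∈)
  ... | y' , y'∈ , x'y' with ∈-++⁻ ys₁ y'∈
  ... | inj₁ p = y' , ∈-++⁺ˡ p , x'y'
  ... | inj₂ (here refl) = contradiction (inj (here refl) (there x'∈) xy x'y') (All.lookup x≢ x'∈)
  ... | inj₂ (there p) = y' , ∈-++⁺ʳ ys₁ p , x'y'

length-≤-by-injection : (f : X → Y) {xs : List X} {ys : List Y} → Unique xs →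
  (∀ {x} → x ∈ xs → f x ∈ ys) →
  (∀ {x x'} → x ∈ xs → x' ∈ xs → f x ≡ f x' → x ≡ x') →
  length xs ℕ.≤ length ys
length-≤-by-injection f u f∈ inj = length-≤-by-relation (λ x y → f x ≡ y) u
  (λ p → _ , f∈ p , refl) (λ { p q refl eq → inj p q (sym eq) })

length-cartesianProductWith : {Z : Set} (f : X → Y → Z) (xs : List X) (ys : List Y) →
  length (cartesianProductWith f xs ys) ≡ length xs ℕ.* length ys
length-cartesianProductWith f [] ys = refl
length-cartesianProductWith f (x ∷ xs) ys
  rewrite length-++ (map (f x) ys) {cartesianProductWith f xs ys}
        | length-map (f x) ys = cong (length ys ℕ.+_) (length-cartesianProductWith f xs ys)

AllPairs-trichotomy : {Q : X → X → Set} {xs : List X} → AllPairs Q xs →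
  ∀ {x y} → x ∈ xs → y ∈ xs → x ≡ y ⊎ Q x y ⊎ Q y x
AllPairs-trichotomy (_ ∷ _) (here refl) (here refl) = inj₁ refl
AllPairs-trichotomy (q ∷ _) (here refl) (there y∈) = inj₂ (inj₁ (All.lookup q y∈))
AllPairs-trichotomy (q ∷ _) (there x∈) (here refl) = inj₂ (inj₂ (All.lookup q x∈))
AllPairs-trichotomy (_ ∷ a) (there x∈) (there y∈) = AllPairs-trichotomy a x∈ y∈

-- Serves two purposes: with equality of images as `R` it yields transversals, with overlap of
-- translates it yields Ruzsa's covering.
record MaximalIndependent (R : X → X → Set) (xs : List X) : Set where
  field
    members      : List X
    ⊆-original   : ∀ {x} → x ∈ members → x ∈ xs
    independent  : AllPairs (λ x y → ¬ R x y) members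
    dominating   : ∀ {x} → x ∈ xs → ∃[ y ] y ∈ members × R x y

maximalIndependent : {R : X → X → Set} → (∀ x y → Dec (R x y)) →
  (xs : List X) → (∀ {x} → x ∈ xs → R x x) → MaximalIndependent R xs
maximalIndependent R? [] _ = record
  { members = [] ; ⊆-original = λ () ; independent = [] ; dominating = λ () }
maximalIndependent {R = R} R? (x ∷ xs) rfl
  with record { members = ys ; ⊆-original = sub ; independent = ind ; dominating = dom }
    ← maximalIndependent R? xs (rfl ∘ there)
  with any? (R? x) ys
... | yes related = record
  { members = ys ; ⊆-original = there ∘ sub ; independent = ind
  ; dominating = λ { (here refl) → find related ; (there p) → dom p } }
... | no unrelated = record
  { members = x ∷ ys
  ; ⊆-original = λ { (here refl) → here refl ; (there p) → there (sub p) }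
  ; independent = All.tabulate (λ p r → unrelated (lose p r)) ∷ ind
  ; dominating = λ { (here refl) → x , here refl , rfl (here refl)
                   ; (there p) → let y , y∈ , r = dom p in y , there y∈ , r } }

-- Besides systems of residues this provides deduplication: `values` is the image without
-- repetitions, so its length is a genuine cardinality.
record Transversal (f : X → Y) (xs : List X) : Set where
  field
    members     : List X
    ⊆-original  : ∀ {x} → x ∈ members → x ∈ xs
    separated   : AllPairs (λ x y → f x ≢ f y) members
    represented : ∀ {x} → x ∈ xs → ∃[ y ] y ∈ members × f x ≡ f y

  unique : Unique members
  unique = AllPairs.map (λ { ne refl → ne refl }) separated

  injective : ∀ {x y} → x ∈ members → y ∈ members → f x ≡ f y → x ≡ y
  injective x∈ y∈ eq with AllPairs-trichotomy separated x∈ y∈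
  ... | inj₁ p = p
  ... | inj₂ (inj₁ ne) = contradiction eq ne
  ... | inj₂ (inj₂ ne) = contradiction (sym eq) ne

  values : List Y
  values = map f members

  values-unique : Unique values
  values-unique = AllPairs.map⁺ separated

  ∈-values⁺ : ∀ {x} → x ∈ xs → f x ∈ values
  ∈-values⁺ x∈ with y , y∈ , eq ← represented x∈ = subst (_∈ values) (sym eq) (∈-map⁺ f y∈)

  ∈-values⁻ : ∀ {v} → v ∈ values → ∃[ x ] x ∈ xs × v ≡ f x
  ∈-values⁻ v∈ with x , x∈ , eq ← ∈-map⁻ f v∈ = x , ⊆-original x∈ , eq

  length-values : length values ≡ length members
  length-values = length-map f members

transversal : DecidableEquality Y → (f : X → Y) (xs : List X) → Transversal f xs
transversal _≟_ f xs = record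
  { members = members ; ⊆-original = ⊆-original
  ; separated = independent ; represented = dominating }
  where open MaximalIndependent (maximalIndependent (λ x y → f x ≟ f y) xs (λ _ → refl))

-- Finite sums, double counting and popularity

∑ : List X → (X → ℕ) → ℕ
∑ [] f = 0
∑ (x ∷ xs) f = f x ℕ.+ ∑ xs f

syntax ∑ xs (λ x → e) = ∑[ x ∈ xs ] e

count : {P : X → Set} → Decidable P → List X → ℕ
count P? xs = length (filter P? xs)

∑-+ : (xs : List X) (f g : X → ℕ) → ∑ xs (λ x → f x ℕ.+ g x) ≡ ∑ xs f ℕ.+ ∑ xs g
∑-+ [] f g = refl
∑-+ (x ∷ xs) f g rewrite ∑-+ xs f g = lem (f x) (g x) (∑ xs f) (∑ xs g)
  where
  lem : ∀ a b c d → a ℕ.+ b ℕ.+ (c ℕ.+ d) ≡ a ℕ.+ c ℕ.+ (b ℕ.+ d)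
  lem = solve-∀

∑-cong : (xs : List X) {f g : X → ℕ} → (∀ x → f x ≡ g x) → ∑ xs f ≡ ∑ xs g
∑-cong [] eq = refl
∑-cong (x ∷ xs) eq = cong₂ ℕ._+_ (eq x) (∑-cong xs eq)

∑-≥ : (xs : List X) {f : X → ℕ} {k : ℕ} → (∀ {x} → x ∈ xs → k ℕ.≤ f x) → length xs ℕ.* k ℕ.≤ ∑ xs f
∑-≥ [] h = z≤n
∑-≥ (x ∷ xs) h = ℕ.+-mono-≤ (h (here refl)) (∑-≥ xs (h ∘ there))

∑-≤ : (xs : List X) {f : X → ℕ} {k : ℕ} → (∀ {x} → x ∈ xs → f x ℕ.≤ k) → ∑ xs f ℕ.≤ length xs ℕ.* k
∑-≤ [] h = z≤n
∑-≤ (x ∷ xs) h = ℕ.+-mono-≤ (h (here refl)) (∑-≤ xs (h ∘ there))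

count-∷ : {P : X → Set} (P? : Decidable P) (x : X) (xs : List X) →
  count P? (x ∷ xs) ≡ count P? (x ∷ []) ℕ.+ count P? xs
count-∷ P? x xs with P? x
... | yes _ = refl
... | no _ = refl

∑-count : {P : X → Set} (P? : Decidable P) (xs : List X) → count P? xs ≡ ∑[ x ∈ xs ] count P? (x ∷ [])
∑-count P? [] = refl
∑-count P? (x ∷ xs) = trans (count-∷ P? x xs) (cong (_ ℕ.+_) (∑-count P? xs))

∑-zero : (xs : List X) → ∑ xs (λ _ → 0) ≡ 0
∑-zero [] = refl
∑-zero (x ∷ xs) = ∑-zero xs

count-singleton : {E : X → Y → Set} (E? : ∀ x y → Dec (E x y)) (x : X) (y : Y) →
  count (E? x) (y ∷ []) ≡ count (λ x' → E? x' y) (x ∷ [])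
count-singleton E? x y with E? x y
... | yes _ = refl
... | no _ = refl

double-count : {E : X → Y → Set} (E? : ∀ x y → Dec (E x y)) (xs : List X) (ys : List Y) →
  ∑[ x ∈ xs ] count (E? x) ys ≡ ∑[ y ∈ ys ] count (λ x → E? x y) xs
double-count E? [] ys = sym (∑-zero ys)
double-count E? (x ∷ xs) ys = trans
  (cong₂ ℕ._+_ (trans (∑-count (E? x) ys) (∑-cong ys (count-singleton E? x))) (double-count E? xs ys))
  (trans (sym (∑-+ ys _ _)) (∑-cong ys (λ y → sym (count-∷ (λ x' → E? x' y) x xs))))

∑-pigeonhole : (xs : List X) {f : X → ℕ} {k : ℕ} → 0 ℕ.< length xs →
  length xs ℕ.* k ℕ.≤ ∑ xs f → ∃[ x ] x ∈ xs × k ℕ.≤ f x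
∑-pigeonhole xs {f} {zero} pos le with x ∷ _ ← xs = x , here refl , z≤n
∑-pigeonhole xs {f} {suc k} pos le with any? (λ x → suc k ℕ.≤? f x) xs
... | yes p = find p
... | no np = contradiction (ℕ.≤-trans le (∑-≤ xs {k = k} λ x∈ → ℕ.s≤s⁻¹ (ℕ.≰⇒> λ q → np (lose x∈ q))))
  (ℕ.<⇒≱ (ℕ.*-monoʳ-< (length xs) {{ℕ.>-nonZero pos}} (ℕ.n<1+n k)))

popular : ℕ → ℕ → (X → ℕ) → List X → List X
popular c h f = filter (λ x → h ℕ.≤? c ℕ.* f x)

-- Each discarded `x` has `c * f x < h`, so it costs less than `h` on the left. The threshold for
-- `f` is `h / c` with its denominator cleared.
∑-popular : ∀ c h (f : X → ℕ) xs →
  c ℕ.* ∑ xs f ℕ.≤ c ℕ.* ∑ (popular c h f xs) f ℕ.+ h ℕ.* length xs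
∑-popular c h f [] = ℕ.m≤m+n _ _
∑-popular {X = X} c h f (x ∷ xs) = go (h ℕ.≤? c ℕ.* f x)
  where
  open ℕ.≤-Reasoning
  s = ∑ (popular c h f xs) f
  accept : ∀ c a s h l → c ℕ.* a ℕ.+ (c ℕ.* s ℕ.+ h ℕ.* l) ℕ.+ h ≡ c ℕ.* (a ℕ.+ s) ℕ.+ h ℕ.* suc l
  accept = solve-∀
  reject : ∀ c s h l → h ℕ.+ (c ℕ.* s ℕ.+ h ℕ.* l) ≡ c ℕ.* s ℕ.+ h ℕ.* suc l
  reject = solve-∀
  go : Dec (h ℕ.≤ c ℕ.* f x) → c ℕ.* (f x ℕ.+ ∑ xs f) ℕ.≤ c ℕ.* ∑ (popular c h f (x ∷ xs)) f ℕ.+ h ℕ.* suc (length xs)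
  go (yes h≤) rewrite filter-accept (λ x → h ℕ.≤? c ℕ.* f x) {xs = xs} h≤ = begin
    c ℕ.* (f x ℕ.+ ∑ xs f)                             ≡⟨ ℕ.*-distribˡ-+ c _ _ ⟩
    c ℕ.* f x ℕ.+ c ℕ.* ∑ xs f                         ≤⟨ ℕ.+-monoʳ-≤ (c ℕ.* f x) (∑-popular c h f xs) ⟩
    c ℕ.* f x ℕ.+ (c ℕ.* s ℕ.+ h ℕ.* length xs)        ≤⟨ ℕ.m≤m+n _ h ⟩
    c ℕ.* f x ℕ.+ (c ℕ.* s ℕ.+ h ℕ.* length xs) ℕ.+ h  ≡⟨ accept c (f x) s h (length xs) ⟩
    c ℕ.* (f x ℕ.+ s) ℕ.+ h ℕ.* suc (length xs)        ∎
  go (no h≰) rewrite filter-reject (λ x → h ℕ.≤? c ℕ.* f x) {xs = xs} h≰ = begin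
    c ℕ.* (f x ℕ.+ ∑ xs f)                             ≡⟨ ℕ.*-distribˡ-+ c _ _ ⟩
    c ℕ.* f x ℕ.+ c ℕ.* ∑ xs f                         ≤⟨ ℕ.+-mono-≤ (ℕ.<⇒≤ (ℕ.≰⇒> h≰)) (∑-popular c h f xs) ⟩
    h ℕ.+ (c ℕ.* s ℕ.+ h ℕ.* length xs)                ≡⟨ reject c s h (length xs) ⟩
    c ℕ.* s ℕ.+ h ℕ.* suc (length xs)                  ∎

dependentPairs : List X → (X → List Y) → List (X × Y)
dependentPairs [] f = []
dependentPairs (x ∷ xs) f = map (x ,_) (f x) ++ dependentPairs xs f

length-dependentPairs : (xs : List X) (f : X → List Y) →
  length (dependentPairs xs f) ≡ ∑[ x ∈ xs ] length (f x)
length-dependentPairs [] f = refl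
length-dependentPairs (x ∷ xs) f
  rewrite length-++ (map (x ,_) (f x)) {dependentPairs xs f} | length-map (x ,_) (f x)
  = cong (_ ℕ.+_) (length-dependentPairs xs f)

∈-dependentPairs⁻ : (xs : List X) {f : X → List Y} {x : X} {y : Y} →
  (x , y) ∈ dependentPairs xs f → x ∈ xs × y ∈ f x
∈-dependentPairs⁻ (x ∷ xs) {f} p with ∈-++⁻ (map (x ,_) (f x)) p
... | inj₁ q with _ , y∈ , refl ← ∈-map⁻ (x ,_) q = here refl , y∈
... | inj₂ q with x∈ , y∈ ← ∈-dependentPairs⁻ xs q = there x∈ , y∈

dependentPairs-unique : {xs : List X} {f : X → List Y} → Unique xs → (∀ x → Unique (f x)) →
  Unique (dependentPairs xs f)
dependentPairs-unique [] uf = []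
dependentPairs-unique {xs = x ∷ xs} {f} (x≢ ∷ u) uf =
  Unique.++⁺ (Unique.map⁺ (λ { refl → refl }) (uf x)) (dependentPairs-unique u uf)
    λ { (p , q) → case-disjoint p q }
  where
  case-disjoint : ∀ {z} → z ∈ map (x ,_) (f x) → ¬ (z ∈ dependentPairs xs f)
  case-disjoint p q with _ , _ , refl ← ∈-map⁻ (x ,_) p =
    All.lookup x≢ (proj₁ (∈-dependentPairs⁻ xs q)) refl

∑-* : (c : ℕ) (xs : List X) (f : X → ℕ) → ∑[ x ∈ xs ] (c ℕ.* f x) ≡ c ℕ.* ∑ xs f
∑-* c [] f = sym (ℕ.*-zeroʳ c)
∑-* c (x ∷ xs) f = trans (cong (c ℕ.* f x ℕ.+_) (∑-* c xs f)) (sym (ℕ.*-distribˡ-+ c (f x) (∑ xs f)))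

∑-mono : (xs : List X) {f g : X → ℕ} → (∀ {x} → x ∈ xs → f x ℕ.≤ g x) → ∑ xs f ℕ.≤ ∑ xs g
∑-mono [] le = z≤n
∑-mono (x ∷ xs) le = ℕ.+-mono-≤ (le (here refl)) (∑-mono xs (le ∘ there))

count-≤ : {P : X → Set} (P? : Decidable P) {xs ys : List X} → Unique xs →
  (∀ {x} → x ∈ xs → P x → x ∈ ys) → count P? xs ℕ.≤ length ys
count-≤ P? {xs} u sub = length-≤-by-injection id (Unique.filter⁺ P? u)
  (λ p → let q , Px = ∈-filter⁻ P? {xs = xs} p in sub q Px) (λ _ _ eq → eq)

-- The graph to be used joins `a` to the products lying in `aA`. Popularity takes the place of
-- Cauchy-Schwarz: restrict to the vertices of `V` of degree at least `u / (2L)`, choose `b`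
-- adjacent to many of them, and keep the `a` that share many neighbours with `b`.
module CommonNeighbours {E : X → Y → Set} (E? : ∀ x y → Dec (E x y))
  {U : List X} {V : List Y} (V-unique : Unique V) {n L : ℕ}
  (U-nonempty : 0 ℕ.< length U) (n>0 : 0 ℕ.< n) (L>0 : 0 ℕ.< L)
  (regular : ∀ {a} → a ∈ U → count (E? a) V ≡ n) (V-small : length V ℕ.≤ L ℕ.* n) where

  codegree : X → X → ℕ
  codegree a b = count (λ v → E? a v ×-dec E? b v) V

  private
    u = length U
    degree : Y → ℕ
    degree v = count (λ a → E? a v) U
    V' = popular (2 ℕ.* L) u degree V
    open ℕ.≤-Reasoning

    -- There are `u * n` edges in all, and the unpopular vertices, at most `L * n` of them with
    -- degree below `u / (2L)`, carry no more than half.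
    V'-edges : u ℕ.* n ℕ.≤ ∑[ b ∈ U ] (2 ℕ.* count (E? b) V')
    V'-edges = ℕ.*-cancelˡ-≤ L {{ℕ.>-nonZero L>0}} (ℕ.+-cancelʳ-≤ (L ℕ.* (u ℕ.* n)) _ _ (begin
      L ℕ.* (u ℕ.* n) ℕ.+ L ℕ.* (u ℕ.* n)              ≡⟨ lem L (u ℕ.* n) ⟩
      2 ℕ.* L ℕ.* (u ℕ.* n)                            ≤⟨ ℕ.*-monoʳ-≤ (2 ℕ.* L) (∑-≥ U (λ a∈ → ℕ.≤-reflexive (sym (regular a∈)))) ⟩
      2 ℕ.* L ℕ.* ∑[ a ∈ U ] count (E? a) V             ≡⟨ cong (2 ℕ.* L ℕ.*_) (double-count E? U V) ⟩
      2 ℕ.* L ℕ.* ∑ V degree                           ≤⟨ ∑-popular (2 ℕ.* L) u degree V ⟩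
      2 ℕ.* L ℕ.* ∑ V' degree ℕ.+ u ℕ.* length V         ≤⟨ ℕ.+-monoʳ-≤ _ (ℕ.*-monoʳ-≤ u V-small) ⟩
      2 ℕ.* L ℕ.* ∑ V' degree ℕ.+ u ℕ.* (L ℕ.* n)        ≡⟨ lem₂ L (∑ V' degree) u n ⟩
      L ℕ.* (2 ℕ.* ∑ V' degree) ℕ.+ L ℕ.* (u ℕ.* n)      ≡⟨ cong (λ z → L ℕ.* (2 ℕ.* z) ℕ.+ L ℕ.* (u ℕ.* n)) (sym (double-count E? U V')) ⟩
      L ℕ.* (2 ℕ.* ∑[ b ∈ U ] count (E? b) V') ℕ.+ L ℕ.* (u ℕ.* n)
        ≡⟨ cong (λ z → L ℕ.* z ℕ.+ L ℕ.* (u ℕ.* n)) (sym (∑-* 2 U _)) ⟩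
      L ℕ.* ∑[ b ∈ U ] (2 ℕ.* count (E? b) V') ℕ.+ L ℕ.* (u ℕ.* n) ∎))
      where
      lem : ∀ L x → L ℕ.* x ℕ.+ L ℕ.* x ≡ 2 ℕ.* L ℕ.* x
      lem = solve-∀
      lem₂ : ∀ L s u n → 2 ℕ.* L ℕ.* s ℕ.+ u ℕ.* (L ℕ.* n) ≡ L ℕ.* (2 ℕ.* s) ℕ.+ L ℕ.* (u ℕ.* n)
      lem₂ = solve-∀

    codegree-≤ : ∀ {a b} → a ∈ U → codegree a b ℕ.≤ n
    codegree-≤ {a} {b} a∈ = ℕ.≤-trans
      (count-≤ _ V-unique (λ v∈ e → ∈-filter⁺ (E? a) v∈ (proj₁ e))) (ℕ.≤-reflexive (regular a∈))

    module _ {b : X} (n≤ : n ℕ.≤ 2 ℕ.* count (E? b) V') where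
      Vb = filter (E? b) V'

      Vb⊆V : ∀ {v} → v ∈ Vb → v ∈ V × E b v
      Vb⊆V p with q , e ← ∈-filter⁻ (E? b) {xs = V'} p = proj₁ (∈-filter⁻ _ {xs = V} q) , e

      Vb-popular : ∀ {v} → v ∈ Vb → u ℕ.≤ 2 ℕ.* L ℕ.* degree v
      Vb-popular p = proj₂ (∈-filter⁻ (λ v → u ℕ.≤? 2 ℕ.* L ℕ.* degree v) {xs = V} (proj₁ (∈-filter⁻ (E? b) {xs = V'} p)))

      Vb-unique : Unique Vb
      Vb-unique = Unique.filter⁺ (E? b) (Unique.filter⁺ _ V-unique)

      -- At least `n / 2` neighbours of `b` are popular. Each of them has at least `u / (2L)`
      -- neighbours `a`, and is counted in the codegree of every such `a` with `b`.
      ∑-codegree : n ℕ.* u ℕ.≤ 4 ℕ.* L ℕ.* ∑[ a ∈ U ] codegree a b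
      ∑-codegree = begin
        n ℕ.* u                                          ≤⟨ ℕ.*-monoˡ-≤ u n≤ ⟩
        2 ℕ.* length Vb ℕ.* u                            ≡⟨ ℕ.*-assoc 2 (length Vb) u ⟩
        2 ℕ.* (length Vb ℕ.* u)                          ≤⟨ ℕ.*-monoʳ-≤ 2 (∑-≥ Vb Vb-popular) ⟩
        2 ℕ.* ∑[ v ∈ Vb ] (2 ℕ.* L ℕ.* degree v)          ≡⟨ cong (2 ℕ.*_) (∑-* (2 ℕ.* L) Vb degree) ⟩
        2 ℕ.* (2 ℕ.* L ℕ.* ∑ Vb degree)                   ≡⟨ cong (λ z → 2 ℕ.* (2 ℕ.* L ℕ.* z)) (sym (double-count E? U Vb)) ⟩
        2 ℕ.* (2 ℕ.* L ℕ.* ∑[ a ∈ U ] count (E? a) Vb)    ≤⟨ ℕ.*-monoʳ-≤ 2 (ℕ.*-monoʳ-≤ (2 ℕ.* L) (∑-mono U λ {a} _ →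
                                                             count-≤ (E? a) Vb-unique λ p e → ∈-filter⁺ _ (proj₁ (Vb⊆V p)) (e , proj₂ (Vb⊆V p)))) ⟩
        2 ℕ.* (2 ℕ.* L ℕ.* ∑[ a ∈ U ] codegree a b)       ≡⟨ lem L (∑[ a ∈ U ] codegree a b) ⟩
        4 ℕ.* L ℕ.* ∑[ a ∈ U ] codegree a b               ∎
        where
        lem : ∀ L s → 2 ℕ.* (2 ℕ.* L ℕ.* s) ≡ 4 ℕ.* L ℕ.* s
        lem = solve-∀

      -- The `a` of codegree below `n / (8L)` supply at most half of the lower bound in
      -- `∑-codegree`, and every other `a` supplies at most `n`.
      many : u ℕ.≤ 8 ℕ.* L ℕ.* length (popular (8 ℕ.* L) n (λ a → codegree a b) U)
      many = ℕ.*-cancelˡ-≤ n {{ℕ.>-nonZero n>0}} (ℕ.+-cancelʳ-≤ (n ℕ.* u) _ _ (begin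
        n ℕ.* u ℕ.+ n ℕ.* u                           ≡⟨ lem (n ℕ.* u) ⟩
        2 ℕ.* (n ℕ.* u)                             ≤⟨ ℕ.*-monoʳ-≤ 2 ∑-codegree ⟩
        2 ℕ.* (4 ℕ.* L ℕ.* s)                         ≡⟨ lem₂ L s ⟩
        8 ℕ.* L ℕ.* s                               ≤⟨ ∑-popular (8 ℕ.* L) n (λ a → codegree a b) U ⟩
        8 ℕ.* L ℕ.* ∑ P (λ a → codegree a b) ℕ.+ n ℕ.* u
          ≤⟨ ℕ.+-monoˡ-≤ (n ℕ.* u) (ℕ.*-monoʳ-≤ (8 ℕ.* L) (∑-≤ P (λ p → codegree-≤ (proj₁ (∈-filter⁻ (λ a → n ℕ.≤? 8 ℕ.* L ℕ.* codegree a b) {xs = U} p))))) ⟩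
        8 ℕ.* L ℕ.* (length P ℕ.* n) ℕ.+ n ℕ.* u        ≡⟨ lem₃ L (length P) n u ⟩
        n ℕ.* (8 ℕ.* L ℕ.* length P) ℕ.+ n ℕ.* u        ∎))
        where
        s = ∑[ a ∈ U ] codegree a b
        P = popular (8 ℕ.* L) n (λ a → codegree a b) U
        lem : ∀ x → x ℕ.+ x ≡ 2 ℕ.* x
        lem = solve-∀
        lem₂ : ∀ L s → 2 ℕ.* (4 ℕ.* L ℕ.* s) ≡ 8 ℕ.* L ℕ.* s
        lem₂ = solve-∀
        lem₃ : ∀ L p n u → 8 ℕ.* L ℕ.* (p ℕ.* n) ℕ.+ n ℕ.* u ≡ n ℕ.* (8 ℕ.* L ℕ.* p) ℕ.+ n ℕ.* u
        lem₃ = solve-∀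

  popular-partner : ∃[ b ] b ∈ U × u ℕ.≤ 8 ℕ.* L ℕ.* length (popular (8 ℕ.* L) n (λ a → codegree a b) U)
  popular-partner with b , b∈ , n≤ ← ∑-pigeonhole U U-nonempty V'-edges = b , b∈ , many n≤

-- A ring solver with subtraction

-- Coefficients are formal differences of natural numbers, because the ring
-- solver must recognise cancelling coefficients and the coefficients of an
-- abstract ring do not compute.
module DifferenceSolver (R : CommutativeRing 0ℓ 0ℓ) where
  open CommutativeRing R renaming (sym to ≈-sym; trans to ≈-trans)
  open Algebra.Properties.Ring ring using (x[y-z]≈xy-xz; [y-z]x≈yx-zx)
  open Algebra.Properties.AbelianGroup +-abelianGroup using (⁻¹-∙-comm; ⁻¹-anti-homo‿-; ε⁻¹≈ε; //-rightDividesʳ)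
  open Algebra.Properties.CommutativeSemigroup +-commutativeSemigroup using (interchange)
  open Algebra.Properties.Semiring.Mult semiring renaming (_×_ to _⨯_; ×-homo-+ to ⨯-homo-+; ×1-homo-* to ⨯1-homo-*; ×-homo-1 to ⨯-homo-1)
  open import Relation.Binary.Reasoning.Setoid setoid

  differences : RawRing 0ℓ 0ℓ
  differences = record
    { Carrier = ℕ × ℕ
    ; _≈_ = λ { (a , b) (c , d) → a ℕ.+ d ≡ c ℕ.+ b }
    ; _+_ = λ { (a , b) (c , d) → a ℕ.+ c , b ℕ.+ d }
    ; _*_ = λ { (a , b) (c , d) → a ℕ.* c ℕ.+ b ℕ.* d , a ℕ.* d ℕ.+ b ℕ.* c }
    ; -_ = λ { (a , b) → b , a }
    ; 0# = 0 , 0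
    ; 1# = 1 , 0
    }

  ⟦_⟧ : ℕ × ℕ → Carrier
  ⟦ a , b ⟧ = a ⨯ 1# - b ⨯ 1#

  sub-interchange : ∀ w x y z → (w - x) + (y - z) ≈ (w + y) - (x + z)
  sub-interchange w x y z = ≈-trans (interchange w (- x) y (- z)) (+-congˡ (⁻¹-∙-comm x z))

  *-expand : ∀ w x y z → (w - x) * (y - z) ≈ (w * y + x * z) - (w * z + x * y)
  *-expand w x y z = begin
    (w - x) * (y - z)                    ≈⟨ [y-z]x≈yx-zx (y - z) w x ⟩
    w * (y - z) - x * (y - z)            ≈⟨ +-cong (x[y-z]≈xy-xz w y z) (-‿cong (x[y-z]≈xy-xz x y z)) ⟩
    (w * y - w * z) - (x * y - x * z)    ≈⟨ +-congˡ (⁻¹-anti-homo‿- (x * y) (x * z)) ⟩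
    (w * y - w * z) + (x * z - x * y)    ≈⟨ sub-interchange _ _ _ _ ⟩
    (w * y + x * z) - (w * z + x * y)    ∎

  ⟦⟧-cong : ∀ a b c d → a ℕ.+ d ≡ c ℕ.+ b → ⟦ a , b ⟧ ≈ ⟦ c , d ⟧
  ⟦⟧-cong a b c d eq = begin
    A - B              ≈⟨ //-rightDividesʳ D (A - B) ⟨
    A - B + D - D      ≈⟨ +-congʳ (≈-trans (+-assoc A (- B) D) (+-congˡ (+-comm (- B) D))) ⟩
    A + (D - B) - D    ≈⟨ +-congʳ (≈-sym (+-assoc A D (- B))) ⟩
    A + D - B - D      ≈⟨ +-congʳ (+-congʳ (≈-trans (≈-sym (⨯-homo-+ 1# a d)) (≈-trans (reflexive (≡.cong (_⨯ 1#) eq)) (⨯-homo-+ 1# c b)))) ⟩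
    C + B - B - D      ≈⟨ +-congʳ (//-rightDividesʳ B C) ⟩
    C - D              ∎
    where
    A = a ⨯ 1#
    B = b ⨯ 1#
    C = c ⨯ 1#
    D = d ⨯ 1#

  morphism : differences -Raw-AlmostCommutative⟶ fromCommutativeRing R
  morphism = record
    { ⟦_⟧ = ⟦_⟧
    ; +-homo = λ { (a , b) (c , d) → ≈-trans
        (+-cong (⨯-homo-+ 1# a c) (-‿cong (⨯-homo-+ 1# b d))) (≈-sym (sub-interchange _ _ _ _)) }
    ; *-homo = λ { (a , b) (c , d) → ≈-trans
        (+-cong (≈-trans (⨯-homo-+ 1# (a ℕ.* c) (b ℕ.* d)) (+-cong (⨯1-homo-* a c) (⨯1-homo-* b d)))
                (-‿cong (≈-trans (⨯-homo-+ 1# (a ℕ.* d) (b ℕ.* c)) (+-cong (⨯1-homo-* a d) (⨯1-homo-* b c)))))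
        (≈-sym (*-expand _ _ _ _)) }
    ; -‿homo = λ { (a , b) → ≈-sym (⁻¹-anti-homo‿- (a ⨯ 1#) (b ⨯ 1#)) }
    ; 0-homo = -‿inverseʳ 0#
    ; 1-homo = ≈-trans (+-cong (⨯-homo-1 1#) ε⁻¹≈ε) (+-identityʳ 1#)
    }

  ⟦⟧-≟ : WeaklyDecidable (Induced-equivalence morphism)
  ⟦⟧-≟ (a , b) (c , d) with a ℕ.+ d ℕ.≟ c ℕ.+ b
  ... | yes eq = just (⟦⟧-cong a b c d eq)
  ... | no _ = nothing

  open Algebra.Solver.Ring differences (fromCommutativeRing R) morphism ⟦⟧-≟ public
    using (solve; _:=_; _:+_; _:*_; _:-_; :-_; con)

-- Sumsets

-- Equals `16 * L ^ 14`. Here `L * L` bounds |A - A| / |A|, `σ` is the cost of adding popular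
-- differences, and `2 * (σ * (L * L))` bounds the number of centres covering A - A, to which
-- popular differences are added twice.
differenceGrowth : ℕ → ℕ
differenceGrowth L = σ ℕ.* (σ ℕ.* (2 ℕ.* (σ ℕ.* (L ℕ.* L))))
  where
  σ = 2 ℕ.* (L ℕ.* L) ℕ.* (L ℕ.* L)

module Sumsets {R : Set} {add mul : Op₂ R} {neg : Op₁ R} {0R 1R : R}
  (isCommutativeRing : IsCommutativeRing _≡_ add mul neg 0R 1R) (_≟_ : DecidableEquality R) where

  ring : CommutativeRing 0ℓ 0ℓ
  ring = record { isCommutativeRing = isCommutativeRing }

  open CommutativeRing ring using (_+_; -_; _-_)
  open DifferenceSolver ring
  open DecMembership _≟_ using (_∈?_)

  infixl 6 _⊕_
  _⊕_ : List R → List R → List R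
  _⊕_ = cartesianProductWith _+_

  +-cancelʳ : ∀ {x y} z → x + z ≡ y + z → x ≡ y
  +-cancelʳ {x} {y} z eq = begin
    x              ≡⟨ lem x z ⟩
    (x + z) - z    ≡⟨ cong (_- z) eq ⟩
    (y + z) - z    ≡⟨ lem y z ⟨
    y              ∎
    where
    open ≡-Reasoning
    lem : ∀ x z → x ≡ (x + z) - z
    lem = solve 2 (λ x z → x := (x :+ z) :- z) refl

  +-cancelˡ : ∀ {x y} z → z + x ≡ z + y → x ≡ y
  +-cancelˡ {x} {y} z eq = +-cancelʳ z (trans (comm x z) (trans eq (comm z y)))
    where
    comm : ∀ x y → x + y ≡ y + x
    comm = solve 2 (λ x y → x :+ y := y :+ x) refl

  record Covering (Z D W : List R) : Set where
    field
      centres   : List R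
      small     : length centres ℕ.* length D ℕ.≤ length W
      covers    : ∀ {z} → z ∈ Z → ∃[ x ] x ∈ centres × ∃[ d ] d ∈ D × ∃[ d' ] d' ∈ D × z + d ≡ x + d'

  -- A maximal family of pairwise disjoint translates `x + D` with `x` in `Z` fits into `W`, which
  -- bounds the number of centres. By maximality every `z + D` meets some `x + D`, which puts `z` in
  -- x + D - D.
  ruzsa-covering : ∀ {Z D W} → Unique D → 0 ℕ.< length D →
    (∀ {z d} → z ∈ Z → d ∈ D → z + d ∈ W) → Covering Z D W
  ruzsa-covering {Z} {D@(d₀ ∷ _)} {W} D-unique _ Z+D⊆W = record
    { centres = members
    ; small = subst (ℕ._≤ length W) (length-cartesianProductWith _,_ members D)
        (length-≤-by-injection (λ { (x , d) → x + d })
          (Unique.cartesianProduct⁺ members-unique D-unique)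
          (λ p → let x∈ , d∈ = ∈-cartesianProduct⁻ members D p in Z+D⊆W (⊆-original x∈) d∈)
          inj)
    ; covers = λ z∈ → let x , x∈ , r = dominating z∈ in x , x∈ , overlap⁻ r }
    where
    Overlap : R → R → Set
    Overlap x y = Any (λ d → Any (λ d' → x + d ≡ y + d') D) D
    overlap⁻ : ∀ {x y} → Overlap x y → ∃[ d ] d ∈ D × ∃[ d' ] d' ∈ D × x + d ≡ y + d'
    overlap⁻ r with d , d∈ , q ← find r with d' , d'∈ , eq ← find q = d , d∈ , d' , d'∈ , eq
    overlap-refl : ∀ x → Overlap x x
    overlap-refl x = here (here refl)
    open MaximalIndependent (maximalIndependent {R = Overlap}
      (λ x y → any? (λ d → any? (λ d' → (x + d) ≟ (y + d')) D) D) Z (λ {x} _ → overlap-refl x))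
    members-unique : Unique members
    members-unique = AllPairs.map (λ { no-overlap refl → no-overlap (overlap-refl _) }) independent

    inj : ∀ {p q} → p ∈ cartesianProduct members D → q ∈ cartesianProduct members D →
      proj₁ p + proj₂ p ≡ proj₁ q + proj₂ q → p ≡ q
    inj {x , d} {x' , d'} p q eq
      with x∈ , d∈ ← ∈-cartesianProduct⁻ members D p
      with x'∈ , d'∈ ← ∈-cartesianProduct⁻ members D q
      with AllPairs-trichotomy independent x∈ x'∈
    ... | inj₁ refl = cong (x ,_) (+-cancelˡ x eq)
    ... | inj₂ (inj₁ ¬o) = contradiction (lose d∈ (lose d'∈ eq)) ¬o
    ... | inj₂ (inj₂ ¬o) = contradiction (lose d'∈ (lose d∈ (sym eq))) ¬o

  -- Lists stand for finite sets and may repeat elements, so that lengths are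
  -- upper bounds: |Y + Z + A| ≤ k |Y + A| for every Y.
  record Growth (A Z : List R) (k : ℕ) : Set where
    field
      grow : ∀ (Y V : List R) → (∀ {y a} → y ∈ Y → a ∈ A → y + a ∈ V) →
        ∃[ V' ] length V' ℕ.≤ k ℕ.* length V × (∀ {y z a} → y ∈ Y → z ∈ Z → a ∈ A → (y + z) + a ∈ V')

  open Growth

  growth-⊆ : ∀ {A Z Z' k k'} → (∀ {z} → z ∈ Z → z ∈ Z') → k ℕ.≤ k' → Growth A Z' k → Growth A Z k'
  growth-⊆ sub k≤ g .grow Y V Y+A⊆V with V' , le , in-V' ← g .grow Y V Y+A⊆V =
    V' , ℕ.≤-trans le (ℕ.*-monoˡ-≤ (length V) k≤) , λ y∈ z∈ a∈ → in-V' y∈ (sub z∈) a∈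

  -- Since `Growth` quantifies over every `Y`, the second hypothesis applies to `Y ⊕ Z`. Hence any
  -- number of sets can be added at the cost of multiplying their constants.
  growth-⊕ : ∀ {A Z Z' k k'} → Growth A Z k → Growth A Z' k' → Growth A (Z ⊕ Z') (k' ℕ.* k)
  growth-⊕ {Z = Z} {Z'} {k} {k'} g g' .grow Y V Y+A⊆V
    with V₁ , le₁ , in₁ ← g .grow Y V Y+A⊆V
    with V₂ , le₂ , in₂ ← g' .grow (Y ⊕ Z) V₁ (λ p a∈ → let y , z , y∈ , z∈ , eq = ∈-cartesianProductWith⁻ _+_ Y Z p in
           subst (λ w → w + _ ∈ V₁) (sym eq) (in₁ y∈ z∈ a∈)) =
    V₂
    , ℕ.≤-trans le₂ (ℕ.≤-trans (ℕ.*-monoʳ-≤ k' le₁) (ℕ.≤-reflexive (sym (ℕ.*-assoc k' k (length V)))))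
    , λ {y} {_} {a} y∈ p a∈ → let z , z' , z∈ , z'∈ , eq = ∈-cartesianProductWith⁻ _+_ Z Z' p in
        subst (_∈ V₂) (trans (assoc y z z' a) (cong (λ w → y + w + a) (sym eq)))
          (in₂ (∈-cartesianProductWith⁺ _+_ y∈ z∈) z'∈ a∈)
    where
    assoc : ∀ y z z' a → y + z + z' + a ≡ y + (z + z') + a
    assoc = solve 4 (λ y z z' a → y :+ z :+ z' :+ a := y :+ (z :+ z') :+ a) refl

  growth-translates : ∀ {A} X → Growth A X (length X)
  growth-translates {A} X .grow Y V Y+A⊆V = X ⊕ V
    , ℕ.≤-reflexive (length-cartesianProductWith _+_ X V)
    , λ {y} {x} {a} y∈ x∈ a∈ → subst (_∈ X ⊕ V) (rearrange x y a) (∈-cartesianProductWith⁺ _+_ x∈ (Y+A⊆V y∈ a∈))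
    where
    rearrange : ∀ x y a → x + (y + a) ≡ y + x + a
    rearrange = solve 3 (λ x y a → x :+ (y :+ a) := y :+ x :+ a) refl

  -- The covering puts `Z` in centres + S - S, and the symmetry of `S` turns - S into + S. The
  -- centres cost their number, and each copy of `S` costs `σ`.
  covered-growth : ∀ {A Z S W σ c} (C : Covering Z S W) → (∀ {s} → s ∈ S → - s ∈ S) →
    Growth A S σ → length (Covering.centres C) ℕ.≤ c → Growth A Z (σ ℕ.* (σ ℕ.* c))
  covered-growth {Z = Z} {S} {σ = σ} C S-neg S-growth centres-small =
    growth-⊆ sub (ℕ.*-monoʳ-≤ σ (ℕ.*-monoʳ-≤ σ centres-small))
      (growth-⊕ {Z' = S} (growth-⊕ {Z' = S} (growth-translates centres) S-growth) S-growth)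
    where
    open Covering C
    solve-for : ∀ {d s x s'} → d + s ≡ x + s' → x + s' + - s ≡ d
    solve-for {d} {s} eq = trans (cong (_- s) (sym eq)) (lem d s)
      where
      lem : ∀ d s → d + s - s ≡ d
      lem = solve 2 (λ d s → d :+ s :- s := d) refl
    sub : ∀ {d} → d ∈ Z → d ∈ centres ⊕ S ⊕ S
    sub d∈ with x , x∈ , s , s∈ , s' , s'∈ , eq ← covers d∈ = subst (_∈ centres ⊕ S ⊕ S) (solve-for eq)
      (∈-cartesianProductWith⁺ _+_ (∈-cartesianProductWith⁺ _+_ x∈ s'∈) (S-neg s∈))

  centres-bound : ∀ {c s w σ d δ n} .{{_ : ℕ.NonZero n}} → n ℕ.≤ 2 ℕ.* s → c ℕ.* s ℕ.≤ w →
    w ℕ.≤ σ ℕ.* d → d ℕ.≤ δ ℕ.* n → c ℕ.≤ 2 ℕ.* (σ ℕ.* δ)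
  centres-bound {c} {s} {w} {σ} {d} {δ} {n} n≤ cs≤ w≤ d≤ = ℕ.*-cancelʳ-≤ c _ n (begin
    c ℕ.* n                  ≤⟨ ℕ.*-monoʳ-≤ c n≤ ⟩
    c ℕ.* (2 ℕ.* s)          ≡⟨ lem c s ⟩
    2 ℕ.* (c ℕ.* s)          ≤⟨ ℕ.*-monoʳ-≤ 2 (ℕ.≤-trans cs≤ (ℕ.≤-trans w≤ (ℕ.*-monoʳ-≤ σ d≤))) ⟩
    2 ℕ.* (σ ℕ.* (δ ℕ.* n))  ≡⟨ lem₂ σ δ n ⟩
    2 ℕ.* (σ ℕ.* δ) ℕ.* n    ∎)
    where
    open ℕ.≤-Reasoning
    lem : ∀ c s → c ℕ.* (2 ℕ.* s) ≡ 2 ℕ.* (c ℕ.* s)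
    lem = solve-∀
    lem₂ : ∀ σ δ n → 2 ℕ.* (σ ℕ.* (δ ℕ.* n)) ≡ 2 ℕ.* (σ ℕ.* δ) ℕ.* n
    lem₂ = solve-∀

  module SmallDoubling {A V : List R} (A-unique : Unique A) (A-nonempty : 0 ℕ.< length A)
    {L : ℕ} (L>0 : 0 ℕ.< L) (A+A⊆V : ∀ {a b} → a ∈ A → b ∈ A → a + b ∈ V)
    (V-small : length V ℕ.≤ L ℕ.* length A) where

    private
      n δ : ℕ
      n = length A
      δ = L ℕ.* L
      instance
        n≢0 : ℕ.NonZero n
        n≢0 = ℕ.>-nonZero A-nonempty
        L≢0 : ℕ.NonZero L
        L≢0 = ℕ.>-nonZero L>0
        δ≢0 : ℕ.NonZero δ
        δ≢0 = ℕ.m*n≢0 L L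
      module ΔT = Transversal (transversal _≟_ (λ (p : R × R) → proj₁ p - proj₂ p) (cartesianProduct A A))
      open ℕ.≤-Reasoning

    differences-of : List R
    differences-of = ΔT.values

    private
      Δ = differences-of

    ∈-Δ⁺ : ∀ {a b} → a ∈ A → b ∈ A → a - b ∈ Δ
    ∈-Δ⁺ a∈ b∈ = ΔT.∈-values⁺ (∈-cartesianProduct⁺ a∈ b∈)

    private
      ∈-Δ⁻ : ∀ {d} → d ∈ Δ → ∃[ a ] a ∈ A × ∃[ b ] b ∈ A × d ≡ a - b
      ∈-Δ⁻ p with (a , b) , q , eq ← ΔT.∈-values⁻ p with a∈ , b∈ ← ∈-cartesianProduct⁻ A A q = a , a∈ , b , b∈ , eq

      neg-sub : ∀ a b → - (a - b) ≡ b - a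
      neg-sub = solve 2 (λ a b → :- (a :- b) := b :- a) refl

      Δ-neg : ∀ {d} → d ∈ Δ → - d ∈ Δ
      Δ-neg p with a , a∈ , b , b∈ , refl ← ∈-Δ⁻ p = subst (_∈ Δ) (sym (neg-sub a b)) (∈-Δ⁺ b∈ a∈)

      -- Ruzsa's inequality |A - A| |A| ≤ |A + A|². With a fixed representation `a - b` of each
      -- difference, the map from (`a - b`, `c`) to (`a + c`, `b + c`) is injective, because
      -- subtracting the coordinates recovers the difference.
      Δ-small : length Δ ℕ.≤ δ ℕ.* n
      Δ-small = ℕ.*-cancelʳ-≤ (length Δ) (δ ℕ.* n) n (begin
        length Δ ℕ.* n                     ≡⟨ cong (ℕ._* n) ΔT.length-values ⟩
        length ΔT.members ℕ.* n            ≡⟨ length-cartesianProductWith _,_ ΔT.members A ⟨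
        length (cartesianProduct ΔT.members A)
          ≤⟨ length-≤-by-injection (λ { ((a , b) , c) → a + c , b + c })
               (Unique.cartesianProduct⁺ ΔT.unique A-unique) in-V inj ⟩
        length (cartesianProduct V V)      ≡⟨ length-cartesianProductWith _,_ V V ⟩
        length V ℕ.* length V              ≤⟨ ℕ.*-mono-≤ V-small V-small ⟩
        L ℕ.* n ℕ.* (L ℕ.* n)              ≡⟨ lem L n ⟩
        δ ℕ.* n ℕ.* n                      ∎)
        where
        lem : ∀ L n → L ℕ.* n ℕ.* (L ℕ.* n) ≡ L ℕ.* L ℕ.* n ℕ.* n
        lem = solve-∀
        in-V : ∀ {p} → p ∈ cartesianProduct ΔT.members A → (proj₁ (proj₁ p) + proj₂ p , proj₂ (proj₁ p) + proj₂ p) ∈ cartesianProduct V V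
        in-V p with q , c∈ ← ∈-cartesianProduct⁻ ΔT.members A p
          with a∈ , b∈ ← ∈-cartesianProduct⁻ A A (ΔT.⊆-original q) = ∈-cartesianProduct⁺ (A+A⊆V a∈ c∈) (A+A⊆V b∈ c∈)
        shift : ∀ a b c → a - b ≡ (a + c) - (b + c)
        shift = solve 3 (λ a b c → a :- b := (a :+ c) :- (b :+ c)) refl
        inj : ∀ {p q} → p ∈ cartesianProduct ΔT.members A → q ∈ cartesianProduct ΔT.members A →
          (proj₁ (proj₁ p) + proj₂ p , proj₂ (proj₁ p) + proj₂ p) ≡ (proj₁ (proj₁ q) + proj₂ q , proj₂ (proj₁ q) + proj₂ q) → p ≡ q
        inj {(a , b) , c} {(a' , b') , c'} p q eq
          with e₁ , e₂ ← ,-injective eq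
          with refl ← ΔT.injective (proj₁ (∈-cartesianProduct⁻ ΔT.members A p)) (proj₁ (∈-cartesianProduct⁻ ΔT.members A q))
                 (trans (shift a b c) (trans (cong₂ _-_ e₁ e₂) (sym (shift a' b' c'))))
          with refl ← +-cancelˡ a e₁ = refl

      reps : R → List R
      reps s = filter (λ c → (s + c) ∈? A) A

      -- The popular differences, which have at least `n / (2δ)` representations.
      S : List R
      S = popular (2 ℕ.* δ) n (length ∘ reps) Δ

      S-unique : Unique S
      S-unique = Unique.filter⁺ _ ΔT.values-unique

      ∈-S⁻ : ∀ {s} → s ∈ S → s ∈ Δ × n ℕ.≤ 2 ℕ.* δ ℕ.* length (reps s)
      ∈-S⁻ = ∈-filter⁻ (λ s → n ℕ.≤? 2 ℕ.* δ ℕ.* length (reps s)) {xs = Δ}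

      ∈-reps⁻ : ∀ s {c} → c ∈ reps s → c ∈ A × s + c ∈ A
      ∈-reps⁻ s = ∈-filter⁻ (λ c → (s + c) ∈? A) {xs = A}

      neg-cancel : ∀ s c → - s + (s + c) ≡ c
      neg-cancel = solve 2 (λ s c → :- s :+ (s :+ c) := c) refl

      S-neg : ∀ {s} → s ∈ S → - s ∈ S
      S-neg {s} p with s∈Δ , n≤ ← ∈-S⁻ p = ∈-filter⁺ _ (Δ-neg s∈Δ) (ℕ.≤-trans n≤ (ℕ.*-monoʳ-≤ (2 ℕ.* δ)
        (length-≤-by-injection (s +_) (Unique.filter⁺ _ A-unique)
          (λ {c} q → let c∈ , sc∈ = ∈-reps⁻ s q in ∈-filter⁺ _ sc∈ (subst (_∈ A) (sym (neg-cancel s c)) c∈))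
          (λ _ _ → +-cancelˡ s))))

      -- Of the `n * n` pairs at most half belong to unpopular differences, of which there are at
      -- most `δ * n`; a popular difference accounts for at most `n` pairs.
      S-large : n ℕ.≤ 2 ℕ.* length S
      S-large = ℕ.*-cancelˡ-≤ n (ℕ.*-cancelˡ-≤ δ (ℕ.+-cancelʳ-≤ (δ ℕ.* (n ℕ.* n)) _ _ (begin
        δ ℕ.* (n ℕ.* n) ℕ.+ δ ℕ.* (n ℕ.* n)                    ≡⟨ lem δ (n ℕ.* n) ⟩
        2 ℕ.* δ ℕ.* (n ℕ.* n)                                ≤⟨ ℕ.*-monoʳ-≤ (2 ℕ.* δ) (∑-≥ A fibre) ⟩
        2 ℕ.* δ ℕ.* ∑[ c ∈ A ] count (λ s → (s + c) ∈? A) Δ    ≡⟨ cong (2 ℕ.* δ ℕ.*_) (sym (double-count (λ s c → (s + c) ∈? A) Δ A)) ⟩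
        2 ℕ.* δ ℕ.* ∑[ s ∈ Δ ] length (reps s)                 ≤⟨ ∑-popular (2 ℕ.* δ) n (length ∘ reps) Δ ⟩
        2 ℕ.* δ ℕ.* ∑[ s ∈ S ] length (reps s) ℕ.+ n ℕ.* length Δ
          ≤⟨ ℕ.+-mono-≤ (ℕ.*-monoʳ-≤ (2 ℕ.* δ) (∑-≤ S (λ {s} _ → count-≤ (λ c → (s + c) ∈? A) A-unique (λ p _ → p)))) (ℕ.*-monoʳ-≤ n Δ-small) ⟩
        2 ℕ.* δ ℕ.* (length S ℕ.* n) ℕ.+ n ℕ.* (δ ℕ.* n)         ≡⟨ lem₂ δ (length S) n ⟩
        δ ℕ.* (n ℕ.* (2 ℕ.* length S)) ℕ.+ δ ℕ.* (n ℕ.* n)       ∎)))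
        where
        lem : ∀ L x → L ℕ.* x ℕ.+ L ℕ.* x ≡ 2 ℕ.* L ℕ.* x
        lem = solve-∀
        lem₂ : ∀ d s n → 2 ℕ.* d ℕ.* (s ℕ.* n) ℕ.+ n ℕ.* (d ℕ.* n) ≡ d ℕ.* (n ℕ.* (2 ℕ.* s)) ℕ.+ d ℕ.* (n ℕ.* n)
        lem₂ = solve-∀
        sub-add : ∀ a c → (a - c) + c ≡ a
        sub-add = solve 2 (λ a c → (a :- c) :+ c := a) refl
        fibre : ∀ {c} → c ∈ A → n ℕ.≤ count (λ s → (s + c) ∈? A) Δ
        fibre {c} c∈ = length-≤-by-injection (_- c) A-unique
          (λ {a} a∈ → ∈-filter⁺ _ (∈-Δ⁺ a∈ c∈) (subst (_∈ A) (sym (sub-add a c)) a∈))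
          (λ _ _ → +-cancelʳ (- c))

      -- Every element `y + s + a` splits as `y + (s + c)` plus `a - c` for at least `n / (2δ)`
      -- values of `c`, whereas only |V| |Δ| ≤ |V| δ n such pairs exist.
      S-growth : Growth A S (2 ℕ.* δ ℕ.* δ)
      S-growth .grow Y V Y+A⊆V = T.values
        , ℕ.*-cancelʳ-≤ (length T.values) _ n (begin
            length T.values ℕ.* n                                 ≡⟨ cong (ℕ._* n) T.length-values ⟩
            length T.members ℕ.* n                                ≤⟨ ∑-≥ T.members (λ p → proj₂ (∈-S⁻ (proj₁ (proj₂ (member p))))) ⟩
            ∑[ t ∈ T.members ] (2 ℕ.* δ ℕ.* length (reps (mid t)))   ≡⟨ ∑-* (2 ℕ.* δ) T.members _ ⟩
            2 ℕ.* δ ℕ.* ∑[ t ∈ T.members ] length (reps (mid t))     ≡⟨ cong (2 ℕ.* δ ℕ.*_) (length-dependentPairs T.members (reps ∘ mid)) ⟨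
            2 ℕ.* δ ℕ.* length Reps
              ≤⟨ ℕ.*-monoʳ-≤ (2 ℕ.* δ) (length-≤-by-injection φ {ys = cartesianProduct V Δ}
                   (dependentPairs-unique T.unique (λ t → Unique.filter⁺ _ A-unique)) φ∈ φ-injective) ⟩
            2 ℕ.* δ ℕ.* length (cartesianProduct V Δ)               ≡⟨ cong (2 ℕ.* δ ℕ.*_) (length-cartesianProductWith _,_ V Δ) ⟩
            2 ℕ.* δ ℕ.* (length V ℕ.* length Δ)                     ≤⟨ ℕ.*-monoʳ-≤ (2 ℕ.* δ) (ℕ.*-monoʳ-≤ (length V) Δ-small) ⟩
            2 ℕ.* δ ℕ.* (length V ℕ.* (δ ℕ.* n))                    ≡⟨ lem δ (length V) n ⟩
            2 ℕ.* δ ℕ.* δ ℕ.* length V ℕ.* n                        ∎)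
        , λ y∈ s∈ a∈ → T.∈-values⁺ (∈-cartesianProduct⁺ y∈ (∈-cartesianProduct⁺ s∈ a∈))
        where
        lem : ∀ d v n → 2 ℕ.* d ℕ.* (v ℕ.* (d ℕ.* n)) ≡ 2 ℕ.* d ℕ.* d ℕ.* v ℕ.* n
        lem = solve-∀
        mid : R × R × R → R
        mid (_ , s , _) = s
        total : R × R × R → R
        total (y , s , a) = y + s + a
        triples = cartesianProduct Y (cartesianProduct S A)
        module T = Transversal (transversal _≟_ total triples)
        Reps = dependentPairs T.members (reps ∘ mid)
        member : ∀ {y s a} → (y , s , a) ∈ T.members → y ∈ Y × s ∈ S × a ∈ A
        member p with y∈ , q ← ∈-cartesianProduct⁻ Y (cartesianProduct S A) (T.⊆-original p)
          with s∈ , a∈ ← ∈-cartesianProduct⁻ S A q = y∈ , s∈ , a∈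
        -- The coordinates of φ sum to y + s + a, which determines (y , s , a).
        φ : (R × R × R) × R → R × R
        φ ((y , s , a) , c) = y + (s + c) , a - c
        φ∈ : ∀ {p} → p ∈ Reps → φ p ∈ cartesianProduct V Δ
        φ∈ {(y , s , a) , c} p with t∈ , q ← ∈-dependentPairs⁻ T.members p
          with y∈ , s∈ , a∈ ← member t∈ with c∈ , sc∈ ← ∈-reps⁻ s q = ∈-cartesianProduct⁺ (Y+A⊆V y∈ sc∈) (∈-Δ⁺ a∈ c∈)
        φ-sum : ∀ y s a c → y + s + a ≡ (y + (s + c)) + (a - c)
        φ-sum = solve 4 (λ y s a c → y :+ s :+ a := (y :+ (s :+ c)) :+ (a :- c)) refl
        φ-injective : ∀ {p q} → p ∈ Reps → q ∈ Reps → φ p ≡ φ q → p ≡ q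
        φ-injective {(y , s , a) , c} {(y' , s' , a') , c'} p q eq with e₁ , e₂ ← ,-injective eq
          with refl ← T.injective (proj₁ (∈-dependentPairs⁻ T.members p)) (proj₁ (∈-dependentPairs⁻ T.members q))
                 (trans (φ-sum y s a c) (trans (cong₂ _+_ e₁ e₂) (sym (φ-sum y' s' a' c'))))
          with refl ← +-cancelˡ s (+-cancelˡ y e₁) = refl

      sub-comm : ∀ a b → a - b ≡ - b + a
      sub-comm = solve 2 (λ a b → a :- b := :- b :+ a) refl

      σ : ℕ
      σ = 2 ℕ.* δ ℕ.* δ

    -- Bounds Δ + S, which gives Δ ⊆ X + S + S with X small, S being symmetric.
    Δ-growth : Growth A Δ (differenceGrowth L)
    -- With -A as `Y` the set Y + A is the difference set itself, so the resulting `W` contains Δ +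
    -- S.
    Δ-growth = conclude (S-growth .grow (map (-_) A) Δ
        (λ {_} {a} p a∈ → let b , b∈ , eq = ∈-map⁻ -_ p in
          subst (_∈ Δ) (trans (sub-comm a b) (cong (_+ a) (sym eq))) (∈-Δ⁺ a∈ b∈)))
      where
      S-nonempty : 0 ℕ.< length S
      S-nonempty = ℕ.*-cancelˡ-< 2 0 (length S) (ℕ.<-≤-trans A-nonempty S-large)
      rearrange : ∀ a b s → (- b + s) + a ≡ (a - b) + s
      rearrange = solve 3 (λ a b s → (:- b :+ s) :+ a := (a :- b) :+ s) refl
      conclude : (∃[ W ] length W ℕ.≤ σ ℕ.* length Δ × (∀ {y s a} → y ∈ map (-_) A → s ∈ S → a ∈ A → y + s + a ∈ W)) →
        Growth A Δ (σ ℕ.* (σ ℕ.* (2 ℕ.* (σ ℕ.* δ))))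
      conclude (W , W-small , in-W) = covered-growth C S-neg S-growth
        (centres-bound {σ = σ} {δ = δ} S-large (Covering.small C) W-small Δ-small)
        where
        C : Covering Δ S W
        C = ruzsa-covering S-unique S-nonempty (λ {_} {s} d∈ s∈ →
          let a , a∈ , b , b∈ , eq = ∈-Δ⁻ d∈ in
          subst (_∈ W) (trans (rearrange a b s) (cong (_+ s) (sym eq))) (in-W (∈-map⁺ -_ b∈) s∈ a∈))

-- Dilates

module UnitCancellation {R : Set} {add mul : Op₂ R} {neg : Op₁ R} {0R 1R : R}
  (isCommutativeRing : IsCommutativeRing _≡_ add mul neg 0R 1R) where

  private
    ring : CommutativeRing 0ℓ 0ℓ
    ring = record { isCommutativeRing = isCommutativeRing }

  open CommutativeRing ring using (_*_; 1#; *-assoc; *-identityˡ)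

  Unit : R → Set
  Unit a = ∃[ u ] u * a ≡ 1#

  unit-cancel : ∀ {a x y} → Unit a → a * x ≡ a * y → x ≡ y
  unit-cancel {a} {x} {y} (u , ua≡1) eq = begin
    x            ≡⟨ *-identityˡ x ⟨
    1# * x       ≡⟨ cong (_* x) ua≡1 ⟨
    u * a * x    ≡⟨ *-assoc u a x ⟩
    u * (a * x)  ≡⟨ cong (u *_) eq ⟩
    u * (a * y)  ≡⟨ *-assoc u a y ⟨
    u * a * y    ≡⟨ cong (_* y) ua≡1 ⟩
    1# * y       ≡⟨ *-identityˡ y ⟩
    y            ∎
    where open ≡-Reasoning

  infixr 7 _·_
  _·_ : R → List R → List R
  c · A = map (c *_) A

  ·-unique : ∀ {c A} → Unit c → Unique A → Unique (c · A)
  ·-unique c-unit = Unique.map⁺ (unit-cancel c-unit)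

-- `L * (8 * L)` translates of D - D cover `A` when `D` contains at least `n / (8L)` elements of
-- `A`; the first factor pays for the differences of `bA`.
stepGrowth : ℕ → ℕ
stepGrowth L = differenceGrowth L ℕ.* (L ℕ.* (8 ℕ.* L))

-- One factor for each of the summands `a₃x`, `-a₄x`, `a₃y`, `-a₄y`, `a₁y`, `-a₂y`; the denominator
-- occurs twice because `x` and `y` vary independently.
dilateGrowth : ℕ → ℕ
dilateGrowth L = k ℕ.* (k ℕ.* (k ℕ.* (k ℕ.* (k ℕ.* k))))
  where k = stepGrowth L

module Dilates {R : Set} {add mul : Op₂ R} {neg : Op₁ R} {0R 1R : R}
  (isCommutativeRing : IsCommutativeRing _≡_ add mul neg 0R 1R) (_≟_ : DecidableEquality R) where

  open Sumsets isCommutativeRing _≟_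
  open UnitCancellation isCommutativeRing
  open CommutativeRing ring using (_+_; _*_; -_; _-_; 0#; +-identityˡ)
  open DifferenceSolver ring
  open DecMembership _≟_ using (_∈?_)

  module _ {A V : List R} {L : ℕ} (A-unique : Unique A) (A-nonempty : 0 ℕ.< length A)
    (A+A⊆V : ∀ {a b} → a ∈ A → b ∈ A → a + b ∈ V) (V-small : length V ℕ.≤ L ℕ.* length A) where

    private
      n = length A
      instance
        n≢0 : ℕ.NonZero n
        n≢0 = ℕ.>-nonZero A-nonempty
      open ℕ.≤-Reasoning

    -- `A` lies in few translates of D - D for a large part `D` of `A`. Multiplication by `c` turns
    -- D - D into cD - cD, which lies in the controlled set `Z`.
    dilate-growth : ∀ {A' Z D κ M} c → Unique D → (∀ {d} → d ∈ D → d ∈ A) → n ℕ.≤ M ℕ.* length D →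
      (∀ {d d'} → d ∈ D → d' ∈ D → c * d' - c * d ∈ Z) → Growth A' Z κ →
      Growth A' (c · A) (κ ℕ.* (L ℕ.* M))
    dilate-growth {A'} {Z} {D} {κ} {M} c D-unique D⊆A D-large cD-cD⊆Z Z-growth =
      growth-⊆ sub (ℕ.*-monoʳ-≤ κ (ℕ.≤-trans (ℕ.≤-reflexive (length-map _ centres)) centres-small))
        (growth-⊕ (growth-translates (c · centres)) Z-growth)
      where
      D-nonempty : 0 ℕ.< length D
      D-nonempty = ℕ.*-cancelˡ-< M 0 (length D) (ℕ.≤-<-trans (ℕ.≤-reflexive (ℕ.*-zeroʳ M)) (ℕ.<-≤-trans A-nonempty D-large))
      open Covering (ruzsa-covering {Z = A} {D} {V} D-unique D-nonempty (λ a∈ d∈ → A+A⊆V a∈ (D⊆A d∈)))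
      centres-small : length centres ℕ.≤ L ℕ.* M
      centres-small = ℕ.*-cancelʳ-≤ (length centres) (L ℕ.* M) n (begin
        length centres ℕ.* n                    ≤⟨ ℕ.*-monoʳ-≤ (length centres) D-large ⟩
        length centres ℕ.* (M ℕ.* length D)     ≡⟨ lem (length centres) M (length D) ⟩
        M ℕ.* (length centres ℕ.* length D)     ≤⟨ ℕ.*-monoʳ-≤ M (ℕ.≤-trans small V-small) ⟩
        M ℕ.* (L ℕ.* n)                         ≡⟨ lem₂ M L n ⟩
        L ℕ.* M ℕ.* n                           ∎)
        where
        lem : ∀ c m d → c ℕ.* (m ℕ.* d) ≡ m ℕ.* (c ℕ.* d)
        lem = solve-∀
        lem₂ : ∀ m l n → m ℕ.* (l ℕ.* n) ≡ l ℕ.* m ℕ.* n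
        lem₂ = solve-∀
      sub : ∀ {z} → z ∈ c · A → z ∈ c · centres ⊕ Z
      sub p with z , z∈ , refl ← ∈-map⁻ (c *_) p with x , x∈ , d , d∈ , d' , d'∈ , eq ← covers z∈ =
        subst (_∈ c · centres ⊕ Z) cz≡ (∈-cartesianProductWith⁺ _+_ (∈-map⁺ (c *_) x∈) (cD-cD⊆Z d∈ d'∈))
        where
        expand : ∀ c x d' d → c * x + (c * d' - c * d) ≡ c * ((x + d') - d)
        expand = solve 4 (λ c x d' d → c :* x :+ (c :* d' :- c :* d) := c :* ((x :+ d') :- d)) refl
        cancel : ∀ c z d → c * ((z + d) - d) ≡ c * z
        cancel = solve 3 (λ c z d → c :* ((z :+ d) :- d) := c :* z) refl
        cz≡ : c * x + (c * d' - c * d) ≡ c * z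
        cz≡ = trans (expand c x d' d) (trans (cong (λ w → c * (w - d)) (sym eq)) (cancel c z d))

    module Partner {b} (b-unit : Unit b) (L>0 : 0 ℕ.< L) where

      private
        A' : List R
        A' = b · A
        A'-length : length A' ≡ n
        A'-length = length-map _ A
        A'+A'⊆V' : ∀ {x y} → x ∈ A' → y ∈ A' → x + y ∈ b · V
        A'+A'⊆V' p q with x , x∈ , refl ← ∈-map⁻ (b *_) p with y , y∈ , refl ← ∈-map⁻ (b *_) q =
          subst (_∈ b · V) (distrib b x y) (∈-map⁺ (b *_) (A+A⊆V x∈ y∈))
          where
          distrib : ∀ b x y → b * (x + y) ≡ b * x + b * y
          distrib = solve 3 (λ b x y → b :* (x :+ y) := b :* x :+ b :* y) refl
        V'-small : length (b · V) ℕ.≤ L ℕ.* length A'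
        V'-small = ℕ.≤-trans (ℕ.≤-reflexive (length-map _ V)) (ℕ.≤-trans V-small (ℕ.≤-reflexive (cong (L ℕ.*_) (sym A'-length))))
        A'-nonempty : 0 ℕ.< length A'
        A'-nonempty = ℕ.<-≤-trans A-nonempty (ℕ.≤-reflexive (sym A'-length))

        module D' = SmallDoubling (·-unique b-unit A-unique) A'-nonempty L>0 A'+A'⊆V' V'-small

      -- Represents aA ∩ bA, pulled back along multiplication by `a`, because the covering argument
      -- needs a subset of `A` itself.
      common : R → List R
      common a = filter (λ x → a * x ∈? A') A

      Good : R → Set
      Good a = n ℕ.≤ 8 ℕ.* L ℕ.* length (common a)

      private
        ∈-common : ∀ a {x} → x ∈ common a → x ∈ A × a * x ∈ A'
        ∈-common a = ∈-filter⁻ (λ x → a * x ∈? A') {xs = A}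

        common-unique : ∀ a → Unique (common a)
        common-unique a = Unique.filter⁺ (λ x → a * x ∈? A') A-unique

      good-growth : ∀ {a} → Good a → Growth A' (a · A) (stepGrowth L)
      good-growth {a} good = dilate-growth a (common-unique a) (proj₁ ∘ ∈-common a) good
        (λ d∈ d'∈ → D'.∈-Δ⁺ (proj₂ (∈-common a d'∈)) (proj₂ (∈-common a d∈))) D'.Δ-growth

      good-growth-neg : ∀ {a} → Good a → Growth A' ((- a) · A) (stepGrowth L)
      good-growth-neg {a} good = dilate-growth (- a) (common-unique a) (proj₁ ∘ ∈-common a) good
        (λ {d} {d'} d∈ d'∈ → subst (_∈ D'.differences-of) (flip-sign a d d')
          (D'.∈-Δ⁺ (proj₂ (∈-common a d∈)) (proj₂ (∈-common a d'∈)))) D'.Δ-growth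
        where
        flip-sign : ∀ a d d' → a * d - a * d' ≡ (- a) * d' - (- a) * d
        flip-sign = solve 3 (λ a d d' → a :* d :- a :* d' := (:- a) :* d' :- (:- a) :* d) refl

      -- This set is a dilate of A + (1 + q) A for q = (a₁ − a₂)/(a₃ − a₄).
      quotient-dilate : ∀ {a₁ a₂ a₃ a₄} → Good a₁ → Good a₂ → Good a₃ → Good a₄ →
        ∃[ W ] length W ℕ.≤ dilateGrowth L ℕ.* n ×
          (∀ {x y} → x ∈ A → y ∈ A → (a₃ - a₄) * x + ((a₃ - a₄) + (a₁ - a₂)) * y ∈ W)
      quotient-dilate {a₁} {a₂} {a₃} {a₄} g₁ g₂ g₃ g₄ = conclude A refl (Growth.grow sums-growth (0# ∷ []) A' from-zero)
        where
        Z : List R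
        Z = a₃ · A ⊕ (- a₄) · A ⊕ a₃ · A ⊕ (- a₄) · A ⊕ a₁ · A ⊕ (- a₂) · A
        sums-growth : Growth A' Z (dilateGrowth L)
        sums-growth =
          growth-⊕ (growth-⊕ (growth-⊕ (growth-⊕ (growth-⊕
            (good-growth g₃) (good-growth-neg g₄)) (good-growth g₃)) (good-growth-neg g₄)) (good-growth g₁)) (good-growth-neg g₂)
        from-zero : ∀ {y a} → y ∈ 0# ∷ [] → a ∈ A' → y + a ∈ A'
        from-zero {a = a} (here refl) a∈ = subst (_∈ A') (sym (+-identityˡ a)) a∈
        conclude : ∀ A₀ → A₀ ≡ A →
          (∃[ V' ] length V' ℕ.≤ dilateGrowth L ℕ.* length A' ×
             (∀ {y z a} → y ∈ 0# ∷ [] → z ∈ Z → a ∈ A' → (y + z) + a ∈ V')) →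
          ∃[ W ] length W ℕ.≤ dilateGrowth L ℕ.* n ×
            (∀ {x y} → x ∈ A → y ∈ A → (a₃ - a₄) * x + ((a₃ - a₄) + (a₁ - a₂)) * y ∈ W)
        conclude [] refl _ = contradiction A-nonempty (λ ())
        -- With 0 as the only `y`, `V'` contains Z + bA. Subtracting one fixed element `b * a₀` of
        -- `bA` leaves a list that contains `Z`.
        conclude (a₀ ∷ _) eq (V' , V'-small , in-V') = map (_- b * a₀) V'
          , ℕ.≤-trans (ℕ.≤-reflexive (length-map _ V')) (ℕ.≤-trans V'-small (ℕ.≤-reflexive (cong (dilateGrowth L ℕ.*_) A'-length)))
          , λ {x} {y} x∈ y∈ → subst (_∈ map (_- b * a₀) V') (identity a₁ a₂ a₃ a₄ x y (b * a₀))
              (∈-map⁺ (_- b * a₀) (in-V' (here refl)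
                (z∈ (z∈ (z∈ (z∈ (z∈ (∈-map⁺ (a₃ *_) x∈) (∈-map⁺ ((- a₄) *_) x∈)) (∈-map⁺ (a₃ *_) y∈)) (∈-map⁺ ((- a₄) *_) y∈))
                  (∈-map⁺ (a₁ *_) y∈)) (∈-map⁺ ((- a₂) *_) y∈))
                (∈-map⁺ (b *_) (subst (a₀ ∈_) eq (here refl)))))
          where
          z∈ : ∀ {xs ys x y} → x ∈ xs → y ∈ ys → x + y ∈ xs ⊕ ys
          z∈ = ∈-cartesianProductWith⁺ _+_
          identity : ∀ a₁ a₂ a₃ a₄ x y w →
            (0# + (a₃ * x + (- a₄) * x + a₃ * y + (- a₄) * y + a₁ * y + (- a₂) * y)) + w - w
              ≡ (a₃ - a₄) * x + ((a₃ - a₄) + (a₁ - a₂)) * y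
          identity a₁ a₂ a₃ a₄ x y w = trans (cong (λ s → s + w - w) (+-identityˡ _)) (solve 7 (λ a₁ a₂ a₃ a₄ x y w →
            (a₃ :* x :+ (:- a₄) :* x :+ a₃ :* y :+ (:- a₄) :* y :+ a₁ :* y :+ (:- a₂) :* y) :+ w :- w
              := (a₃ :- a₄) :* x :+ ((a₃ :- a₄) :+ (a₁ :- a₂)) :* y) refl a₁ a₂ a₃ a₄ x y w)

-- Quotients and residues

length-filter-∁ : {X : Set} {P : X → Set} (P? : Decidable P) (xs : List X) →
  length xs ≡ count P? xs ℕ.+ count (¬? ∘ P?) xs
length-filter-∁ P? [] = refl
length-filter-∁ P? (x ∷ xs) with P? x
... | yes _ = cong suc (length-filter-∁ P? xs)
... | no _ = trans (cong suc (length-filter-∁ P? xs)) (sym (ℕ.+-suc _ _))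

length≤1 : {X : Set} {Q : X → X → Set} {xs : List X} → AllPairs Q xs →
  length xs ℕ.≤ 1 ⊎ ∃[ x ] x ∈ xs × ∃[ y ] y ∈ xs × Q x y
length≤1 [] = inj₁ z≤n
length≤1 (_ ∷ []) = inj₁ (s≤s z≤n)
length≤1 ((q ∷ _) ∷ _ ∷ _) = inj₂ (_ , here refl , _ , there (here refl) , q)

-- Reduction mod `p` enters through two properties: translation respects its fibres, and elements of
-- different fibres differ by a unit.
module Residues {R : Set} {add mul : Op₂ R} {neg : Op₁ R} {0R 1R : R}
  (isCommutativeRing : IsCommutativeRing _≡_ add mul neg 0R 1R) (_≟_ : DecidableEquality R)
  {F : Set} (_≟F_ : DecidableEquality F) (π : R → F)
  (π-shift : ∀ {a b} c → π a ≡ π b → π (add a c) ≡ π (add b c))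
  (π-unit : ∀ {a b} → π a ≢ π b → UnitCancellation.Unit isCommutativeRing (add a (neg b))) where

  open Sumsets isCommutativeRing _≟_ using (ring; +-cancelʳ)
  open UnitCancellation isCommutativeRing
  open CommutativeRing ring using (_+_; _*_; -_; _-_; 0#; 1#; *-assoc; *-identityˡ; zeroʳ; -‿inverseʳ)
  open DifferenceSolver ring
  open ℕ.≤-Reasoning

  -- The equation says t - b' = t' - b, so `t` and `t'` are translates of `b'` and `b` by the same
  -- element.
  π-cancelˡ : ∀ {b b' t t'} → π b ≡ π b' → b + t ≡ b' + t' → π t ≡ π t'
  π-cancelˡ {b} {b'} {t} {t'} πb eq = trans (cong π (lem b b' t))
    (trans (sym (π-shift (b + t - b - b') πb)) (trans (cong (λ w → π (b + (w - b - b'))) eq) (cong π (lem₂ b b' t'))))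
    where
    lem : ∀ b b' t → t ≡ b' + (b + t - b - b')
    lem = solve 3 (λ b b' t → t := b' :+ (b :+ t :- b :- b')) refl
    lem₂ : ∀ b b' t' → b + (b' + t' - b - b') ≡ t'
    lem₂ = solve 3 (λ b b' t' → b :+ (b' :+ t' :- b :- b') := t') refl

  module _ {A V : List R} (T : Transversal π A)
    (A+A⊆V : ∀ {a b} → a ∈ A → b ∈ A → a + b ∈ V) where

    private
      module T = Transversal T

    -- The residue of `b` together with `b + t` fixes the residue of `t`, hence `t` in the
    -- transversal, hence `b`. With 0 alone in `Q` this limits the non-units of `A`; with the
    -- residues of `B` it carries bounds from `B` to `A`.
    residues-bound : ∀ {B Q} → Unique B → (∀ {b} → b ∈ B → b ∈ A) →
      (∀ {b} → b ∈ B → ∃[ q ] q ∈ Q × π b ≡ π q) →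
      length B ℕ.* length T.members ℕ.≤ length Q ℕ.* length V
    residues-bound {B} {Q} B-unique B⊆A rep =
      subst₂ ℕ._≤_ (length-cartesianProductWith _,_ B T.members) (length-cartesianProductWith _,_ Q V)
        (length-≤-by-relation (λ { (b , t) (q , v) → π b ≡ π q × v ≡ b + t })
          (Unique.cartesianProduct⁺ B-unique T.unique) image injective)
      where
      image : ∀ {p} → p ∈ cartesianProduct B T.members →
        ∃[ r ] r ∈ cartesianProduct Q V × (π (proj₁ p) ≡ π (proj₁ r) × proj₂ r ≡ proj₁ p + proj₂ p)
      image {b , t} p with b∈ , t∈ ← ∈-cartesianProduct⁻ B T.members p with q , q∈ , πb≡πq ← rep b∈ =
        (q , b + t) , ∈-cartesianProduct⁺ q∈ (A+A⊆V (B⊆A b∈) (T.⊆-original t∈)) , πb≡πq , refl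
      injective : ∀ {p p' r} → p ∈ cartesianProduct B T.members → p' ∈ cartesianProduct B T.members →
        π (proj₁ p) ≡ π (proj₁ r) × proj₂ r ≡ proj₁ p + proj₂ p →
        π (proj₁ p') ≡ π (proj₁ r) × proj₂ r ≡ proj₁ p' + proj₂ p' → p ≡ p'
      injective {b , t} {b' , t'} p p' (πb , e) (πb' , e')
        with refl ← T.injective (proj₂ (∈-cartesianProduct⁻ B T.members p)) (proj₂ (∈-cartesianProduct⁻ B T.members p'))
               (π-cancelˡ (trans πb (sym πb')) (trans (sym e) e')) = cong (_, t) (+-cancelʳ t (trans (sym e) e'))

    module Expansion {B : List R} {L E : ℕ} (L>0 : 0 ℕ.< L) (E>0 : 0 ℕ.< E)
      (A-unique : Unique A) (A-nonempty : 0 ℕ.< length A) (V-small : length V ℕ.≤ L ℕ.* length A)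
      (B-unique : Unique B) (B⊆A : ∀ {b} → b ∈ B → b ∈ A)
      (B-large : length A ℕ.≤ 16 ℕ.* L ℕ.* length B)
      (quotient-dilate : ∀ {a₁ a₂ a₃ a₄} → a₁ ∈ B → a₂ ∈ B → a₃ ∈ B → a₄ ∈ B →
        ∃[ W ] length W ℕ.≤ E ℕ.* length A ×
          (∀ {x y} → x ∈ A → y ∈ A → (a₃ - a₄) * x + ((a₃ - a₄) + (a₁ - a₂)) * y ∈ W)) where

      private
        n t : ℕ
        n = length A
        t = length T.members
        instance
          n≢0 : ℕ.NonZero n
          n≢0 = ℕ.>-nonZero A-nonempty
          L≢0 : ℕ.NonZero L
          L≢0 = ℕ.>-nonZero L>0
          E≢0 : ℕ.NonZero E
          E≢0 = ℕ.>-nonZero E>0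

      IsQuotient : R → R × R × R × R → Set
      IsQuotient q (a₁ , a₂ , a₃ , a₄) = π a₃ ≢ π a₄ × (a₃ - a₄) * q ≡ a₁ - a₂

      quadruples : List (R × R × R × R)
      quadruples = cartesianProduct B (cartesianProduct B (cartesianProduct B B))

      Quotient : R → Set
      Quotient q = Any (IsQuotient q) quadruples

      quotient? : Decidable Quotient
      quotient? q = any? (λ (a₁ , a₂ , a₃ , a₄) → ¬? (π a₃ ≟F π a₄) ×-dec (((a₃ - a₄) * q) ≟ (a₁ - a₂))) quadruples

      quotient⁺ : ∀ {q a₁ a₂ a₃ a₄} → a₁ ∈ B → a₂ ∈ B → a₃ ∈ B → a₄ ∈ B →
        π a₃ ≢ π a₄ → (a₃ - a₄) * q ≡ a₁ - a₂ → Quotient q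
      quotient⁺ m₁ m₂ m₃ m₄ ne eq = lose (∈-cartesianProduct⁺ m₁ (∈-cartesianProduct⁺ m₂ (∈-cartesianProduct⁺ m₃ m₄))) (ne , eq)

      -- Boundedness of |A + ξA|, the goodness of a ring element. The earlier predicate `Good` is a
      -- different one: it concerns the size of aA ∩ bA.
      Dilate : R → Set
      Dilate ξ = ∃[ W ] length W ℕ.≤ E ℕ.* n × (∀ {x y} → x ∈ A → y ∈ A → x + ξ * y ∈ W)

      quotient-dilate-unscaled : ∀ {q} → Quotient q → Dilate (1# + q)
      quotient-dilate-unscaled {q} Qq
        with (a₁ , a₂ , a₃ , a₄) , m , ne , eq ← find Qq
        with m₁ , m' ← ∈-cartesianProduct⁻ B (cartesianProduct B (cartesianProduct B B)) m
        with m₂ , m'' ← ∈-cartesianProduct⁻ B (cartesianProduct B B) m'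
        with m₃ , m₄ ← ∈-cartesianProduct⁻ B B m''
        with W , W-small , in-W ← quotient-dilate m₁ m₂ m₃ m₄
        with u , u-inverse ← π-unit ne =
        map (u *_) W , ℕ.≤-trans (ℕ.≤-reflexive (length-map _ W)) W-small
        , λ {x} {y} x∈ y∈ → subst (_∈ map (u *_) W) (rescale x y) (∈-map⁺ (u *_) (in-W x∈ y∈))
        where
        factor : ∀ d q x y → d * x + (d + d * q) * y ≡ d * (x + (y + q * y))
        factor = solve 4 (λ d q x y → d :* x :+ (d :+ d :* q) :* y := d :* (x :+ (y :+ q :* y))) refl
        distrib : ∀ o q x y → x + (o * y + q * y) ≡ x + (o + q) * y
        distrib = solve 4 (λ o q x y → x :+ (o :* y :+ q :* y) := x :+ (o :+ q) :* y) refl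
        rescale : ∀ x y → u * ((a₃ - a₄) * x + ((a₃ - a₄) + (a₁ - a₂)) * y) ≡ x + (1# + q) * y
        rescale x y = E.begin
          u * (d * x + (d + (a₁ - a₂)) * y)  E.≡⟨ cong (λ w → u * (d * x + (d + w) * y)) (sym eq) ⟩
          u * (d * x + (d + d * q) * y)      E.≡⟨ cong (u *_) (factor d q x y) ⟩
          u * (d * (x + (y + q * y)))        E.≡⟨ *-assoc u d _ ⟨
          u * d * (x + (y + q * y))          E.≡⟨ cong (_* (x + (y + q * y))) u-inverse ⟩
          1# * (x + (y + q * y))             E.≡⟨ *-identityˡ _ ⟩
          x + (y + q * y)                    E.≡⟨ cong (λ w → x + (w + q * y)) (sym (*-identityˡ y)) ⟩
          x + (1# * y + q * y)               E.≡⟨ distrib 1# q x y ⟩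
          x + (1# + q) * y                   E.∎
          where
          module E = ≡-Reasoning
          d = a₃ - a₄

      private
        -- Used in both directions of the argument: it exhibits `ξ` as a quotient when the map fails
        -- to be injective, and it determines `ξ` from the colliding pairs when `s - s'` is a unit.
        collision : ∀ a a' s s' ξ → a + ξ * s ≡ a' + ξ * s' → (s - s') * ξ ≡ a' - a
        collision a a' s s' ξ eq = trans (lem a s s' ξ) (trans (cong (λ w → w - a - ξ * s') eq) (lem₂ a a' s' ξ))
          where
          lem : ∀ a s s' ξ → (s - s') * ξ ≡ a + ξ * s - a - ξ * s'
          lem = solve 4 (λ a s s' ξ → (s :- s') :* ξ := a :+ ξ :* s :- a :- ξ :* s') refl
          lem₂ : ∀ a a' s' ξ → a' + ξ * s' - a - ξ * s' ≡ a' - a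
          lem₂ = solve 4 (λ a a' s' ξ → a' :+ ξ :* s' :- a :- ξ :* s' := a' :- a) refl

        module B̄ = Transversal (transversal _≟F_ π B)

        -- `B` is a large part of `A`, so `residues-bound` with the residues of `B` as `Q` shows
        -- that `A` cannot meet many more classes than `B` does.
        t≤residues : t ℕ.≤ 16 ℕ.* L ℕ.* L ℕ.* length B̄.members
        t≤residues = ℕ.*-cancelʳ-≤ t _ n (begin
          t ℕ.* n                                    ≤⟨ ℕ.*-monoʳ-≤ t B-large ⟩
          t ℕ.* (16 ℕ.* L ℕ.* length B)              ≡⟨ lem t L (length B) ⟩
          16 ℕ.* L ℕ.* (length B ℕ.* t)              ≤⟨ ℕ.*-monoʳ-≤ (16 ℕ.* L) (residues-bound B-unique B⊆A B̄.represented) ⟩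
          16 ℕ.* L ℕ.* (length B̄.members ℕ.* length V)   ≤⟨ ℕ.*-monoʳ-≤ (16 ℕ.* L) (ℕ.*-monoʳ-≤ (length B̄.members) V-small) ⟩
          16 ℕ.* L ℕ.* (length B̄.members ℕ.* (L ℕ.* n))  ≡⟨ lem₂ L (length B̄.members) n ⟩
          16 ℕ.* L ℕ.* L ℕ.* length B̄.members ℕ.* n  ∎)
          where
          lem : ∀ t L b → t ℕ.* (16 ℕ.* L ℕ.* b) ≡ 16 ℕ.* L ℕ.* (b ℕ.* t)
          lem = solve-∀
          lem₂ : ∀ L q n → 16 ℕ.* L ℕ.* (q ℕ.* (L ℕ.* n)) ≡ 16 ℕ.* L ℕ.* L ℕ.* q ℕ.* n
          lem₂ = solve-∀

        residues-small : ∀ {ξ} → ¬ Quotient ξ → Dilate ξ → length B̄.members ℕ.≤ 16 ℕ.* L ℕ.* E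
        residues-small {ξ} ¬Qξ (W , W-small , in-W) = ℕ.*-cancelʳ-≤ (length B̄.members) _ n (begin
          r ℕ.* n                                    ≤⟨ ℕ.*-monoʳ-≤ r B-large ⟩
          r ℕ.* (16 ℕ.* L ℕ.* length B)              ≡⟨ lem r L (length B) ⟩
          16 ℕ.* L ℕ.* (length B ℕ.* r)              ≡⟨ cong (16 ℕ.* L ℕ.*_) (sym (length-cartesianProductWith _,_ B B̄.members)) ⟩
          16 ℕ.* L ℕ.* length (cartesianProduct B B̄.members)
            ≤⟨ ℕ.*-monoʳ-≤ (16 ℕ.* L) (length-≤-by-injection (λ { (b , s) → b + ξ * s })
                 (Unique.cartesianProduct⁺ B-unique B̄.unique)
                 (λ p → let b∈ , s∈ = ∈-cartesianProduct⁻ B B̄.members p in in-W (B⊆A b∈) (B⊆A (B̄.⊆-original s∈)))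
                 injective) ⟩
          16 ℕ.* L ℕ.* length W                      ≤⟨ ℕ.*-monoʳ-≤ (16 ℕ.* L) W-small ⟩
          16 ℕ.* L ℕ.* (E ℕ.* n)                     ≡⟨ ℕ.*-assoc (16 ℕ.* L) E n ⟨
          16 ℕ.* L ℕ.* E ℕ.* n                       ∎)
          where
          r = length B̄.members
          lem : ∀ t L b → t ℕ.* (16 ℕ.* L ℕ.* b) ≡ 16 ℕ.* L ℕ.* (b ℕ.* t)
          lem = solve-∀
          injective : ∀ {p q} → p ∈ cartesianProduct B B̄.members → q ∈ cartesianProduct B B̄.members →
            proj₁ p + ξ * proj₂ p ≡ proj₁ q + ξ * proj₂ q → p ≡ q
          injective {b , s} {b' , s'} p q eq with π s ≟F π s'
          ... | no πs≢ = contradiction (quotient⁺ (proj₁ (∈-cartesianProduct⁻ B B̄.members q)) (proj₁ (∈-cartesianProduct⁻ B B̄.members p))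
                  (B̄.⊆-original (proj₂ (∈-cartesianProduct⁻ B B̄.members p))) (B̄.⊆-original (proj₂ (∈-cartesianProduct⁻ B B̄.members q)))
                  πs≢ (collision b b' s s' ξ eq)) ¬Qξ
          ... | yes πs≡ with refl ← B̄.injective (proj₂ (∈-cartesianProduct⁻ B B̄.members p)) (proj₂ (∈-cartesianProduct⁻ B B̄.members q)) πs≡ =
                  cong (_, s) (+-cancelʳ (ξ * s) eq)

      -- Exactly `2 * E` residues are kept, so there are twice as many pairs as A + ξA has room for,
      -- and at least `E * n` of them repeat a value for every `ξ`. As a colliding couple of pairs
      -- determines `ξ`, |R| `E * n` is at most the square of `2 * (E * n)`. A longer transversal
      -- would only enlarge this square.
      module AllDilates {univ : List R} (univ-unique : Unique univ) (dilate : ∀ ξ → Dilate ξ)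
        (t-large : 2 ℕ.* E ℕ.≤ t) where

        private
          T' : List R
          T' = take (2 ℕ.* E) T.members
          T'⊆T : ∀ {s} → s ∈ T' → s ∈ T.members
          T'⊆T p = subst (_ ∈_) (take++drop≡id (2 ℕ.* E) T.members) (∈-++⁺ˡ p)
          T'-length : length T' ≡ 2 ℕ.* E
          T'-length = trans (length-take (2 ℕ.* E) T.members) (ℕ.m≤n⇒m⊓n≡m t-large)
          pairs = cartesianProduct A T'
          pairs-unique : Unique pairs
          pairs-unique = Unique.cartesianProduct⁺ A-unique (Unique.take⁺ (2 ℕ.* E) T.unique)
          pairs-length : length pairs ≡ 2 ℕ.* (E ℕ.* n)
          pairs-length = trans (length-cartesianProductWith _,_ A T') (trans (cong (n ℕ.*_) T'-length) (lem n E))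
            where
            lem : ∀ n E → n ℕ.* (2 ℕ.* E) ≡ 2 ℕ.* (E ℕ.* n)
            lem = solve-∀
          value : R → R × R → R
          value ξ (a , s) = a + ξ * s
          module S ξ = Transversal (transversal _≟_ (value ξ) pairs)
          open DecMembership (≡-dec _≟_ _≟_) using () renaming (_∈?_ to _∈₂?_)

          duplicates : R → List (R × R)
          duplicates ξ = filter (λ p → ¬? (p ∈₂? S.members ξ)) pairs

          duplicates-large : ∀ ξ → E ℕ.* n ℕ.≤ length (duplicates ξ)
          duplicates-large ξ = ℕ.+-cancelˡ-≤ (E ℕ.* n) _ _ (begin
            E ℕ.* n ℕ.+ E ℕ.* n                ≡⟨ lem (E ℕ.* n) ⟩
            2 ℕ.* (E ℕ.* n)                    ≡⟨ pairs-length ⟨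
            length pairs                       ≡⟨ length-filter-∁ (_∈₂? S.members ξ) pairs ⟩
            count (_∈₂? S.members ξ) pairs ℕ.+ length (duplicates ξ)
              ≤⟨ ℕ.+-monoˡ-≤ _ (ℕ.≤-trans (count-≤ (_∈₂? S.members ξ) pairs-unique (λ _ m → m)) (values-few (dilate ξ))) ⟩
            E ℕ.* n ℕ.+ length (duplicates ξ)  ∎)
            where
            lem : ∀ x → x ℕ.+ x ≡ 2 ℕ.* x
            lem = solve-∀
            values-few : Dilate ξ → length (S.members ξ) ℕ.≤ E ℕ.* n
            values-few (W , W-small , in-W) = ℕ.≤-trans
              (length-≤-by-injection (value ξ) (S.unique ξ)
                (λ p → let a∈ , s∈ = ∈-cartesianProduct⁻ A T' (S.⊆-original ξ p) in in-W a∈ (T.⊆-original (T'⊆T s∈)))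
                (S.injective ξ)) W-small

          Collide : R × R × R → (R × R) × (R × R) → Set
          Collide (ξ , p) (p' , q) = p' ≡ p × q ∈ pairs × p ≢ q × value ξ p ≡ value ξ q

          collides : ∀ {x} → x ∈ dependentPairs univ duplicates → ∃[ y ] y ∈ cartesianProduct pairs pairs × Collide x y
          collides {ξ , p} x∈ with _ , p∈ ← ∈-dependentPairs⁻ univ {duplicates} x∈
            with p∈pairs , p∉S ← ∈-filter⁻ (λ p → ¬? (p ∈₂? S.members ξ)) {xs = pairs} p∈
            with q , q∈ , eq ← S.represented ξ p∈pairs =
            (p , q) , ∈-cartesianProduct⁺ p∈pairs (S.⊆-original ξ q∈)
            , refl , S.⊆-original ξ q∈ , (λ { refl → p∉S q∈ }) , eq

          -- Two distinct pairs collide for at most one ξ, because distinct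
          -- members of T differ by a unit.
          collide-injective : ∀ {x x' y} → x ∈ dependentPairs univ duplicates → x' ∈ dependentPairs univ duplicates →
            Collide x y → Collide x' y → x ≡ x'
          collide-injective {ξ , (a , s)} {ξ' , _} {_ , (a' , s')} x∈ x'∈ (refl , q∈ , p≢q , eq) (refl , _ , _ , eq')
            with _ , p∈ ← ∈-dependentPairs⁻ univ {duplicates} x∈
            with p∈pairs , _ ← ∈-filter⁻ (λ p → ¬? (p ∈₂? S.members ξ)) {xs = pairs} p∈
            with π s ≟F π s'
          ... | no πs≢ = cong (_, (a , s)) (unit-cancel (π-unit πs≢) (trans (collision a a' s s' ξ eq) (sym (collision a a' s s' ξ' eq'))))
          ... | yes πs≡ with refl ← T.injective (T'⊆T (proj₂ (∈-cartesianProduct⁻ A T' p∈pairs))) (T'⊆T (proj₂ (∈-cartesianProduct⁻ A T' q∈))) πs≡ =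
            contradiction (cong (_, s) (+-cancelʳ (ξ * s) eq)) p≢q

        ring-small : length univ ℕ.≤ 4 ℕ.* E ℕ.* n
        ring-small = ℕ.*-cancelʳ-≤ (length univ) _ (E ℕ.* n) {{ℕ.m*n≢0 E n}} (begin
          length univ ℕ.* (E ℕ.* n)                     ≤⟨ ∑-≥ univ (λ {ξ} _ → duplicates-large ξ) ⟩
          ∑[ ξ ∈ univ ] length (duplicates ξ)           ≡⟨ length-dependentPairs univ duplicates ⟨
          length (dependentPairs univ duplicates)
            ≤⟨ length-≤-by-relation Collide (dependentPairs-unique univ-unique (λ ξ → Unique.filter⁺ (λ p → ¬? (p ∈₂? S.members ξ)) pairs-unique)) collides collide-injective ⟩
          length (cartesianProduct pairs pairs)         ≡⟨ length-cartesianProductWith _,_ pairs pairs ⟩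
          length pairs ℕ.* length pairs                 ≡⟨ cong₂ ℕ._*_ pairs-length pairs-length ⟩
          2 ℕ.* (E ℕ.* n) ℕ.* (2 ℕ.* (E ℕ.* n))          ≡⟨ lem E n ⟩
          4 ℕ.* E ℕ.* n ℕ.* (E ℕ.* n)                   ∎)
          where
          lem : ∀ E n → 2 ℕ.* (E ℕ.* n) ℕ.* (2 ℕ.* (E ℕ.* n)) ≡ 4 ℕ.* E ℕ.* n ℕ.* (E ℕ.* n)
          lem = solve-∀

      -- Being a quotient is decidable and the ring is finite, so a search either finds the place
      -- where closure under adding 1 fails or proves closure, which `generated` turns into an
      -- induction.
      few-residues⊎dense : {univ : List R} → Unique univ → (∀ x → x ∈ univ) →
        ((P : R → Set) → P 0# → (∀ x → P x → P (1# + x)) → ∀ x → P x) →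
        t ℕ.≤ 256 ℕ.* (L ℕ.* L ℕ.* L) ℕ.* E ⊎ length univ ℕ.≤ 4 ℕ.* E ℕ.* n
      few-residues⊎dense {univ} univ-unique univ-complete generated
        with any? (λ q → quotient? q ×-dec ¬? (quotient? (1# + q))) univ
      ... | yes found = inj₁ (let q , _ , Qq , ¬Qq' = find found in begin
          t                                             ≤⟨ t≤residues ⟩
          16 ℕ.* L ℕ.* L ℕ.* length B̄.members           ≤⟨ ℕ.*-monoʳ-≤ (16 ℕ.* L ℕ.* L) (residues-small ¬Qq' (quotient-dilate-unscaled Qq)) ⟩
          16 ℕ.* L ℕ.* L ℕ.* (16 ℕ.* L ℕ.* E)           ≡⟨ lem L E ⟩
          256 ℕ.* (L ℕ.* L ℕ.* L) ℕ.* E                  ∎)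
        where
        lem : ∀ L E → 16 ℕ.* L ℕ.* L ℕ.* (16 ℕ.* L ℕ.* E) ≡ 256 ℕ.* (L ℕ.* L ℕ.* L) ℕ.* E
        lem = solve-∀
      -- The induction starts at 0, which is a quotient as soon as some denominator exists, that is,
      -- when `B` meets two classes. A single class is already few.
      ... | no none with length≤1 B̄.separated
      ... | inj₁ r≤1 = inj₁ (begin
          t                                             ≤⟨ t≤residues ⟩
          16 ℕ.* L ℕ.* L ℕ.* length B̄.members           ≤⟨ ℕ.*-monoʳ-≤ (16 ℕ.* L ℕ.* L) (ℕ.≤-trans r≤1 (ℕ.*-mono-≤ (ℕ.*-mono-≤ {1} {16} (s≤s z≤n) L>0) E>0)) ⟩
          16 ℕ.* L ℕ.* L ℕ.* (16 ℕ.* L ℕ.* E)           ≡⟨ lem L E ⟩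
          256 ℕ.* (L ℕ.* L ℕ.* L) ℕ.* E                  ∎)
        where
        lem : ∀ L E → 16 ℕ.* L ℕ.* L ℕ.* (16 ℕ.* L ℕ.* E) ≡ 256 ℕ.* (L ℕ.* L ℕ.* L) ℕ.* E
        lem = solve-∀
      ... | inj₂ (a₃ , a₃∈ , a₄ , a₄∈ , ne) with 2 ℕ.* E ℕ.≤? t
      ...   | no 2E≰t = inj₁ (ℕ.≤-trans (ℕ.<⇒≤ (ℕ.≰⇒> 2E≰t)) (ℕ.*-monoˡ-≤ E {2} {256 ℕ.* (L ℕ.* L ℕ.* L)}
                (ℕ.≤-trans (ℕ.≤ᵇ⇒≤ 2 256 _) (ℕ.m≤m*n 256 (L ℕ.* L ℕ.* L) {{ℕ.m*n≢0 (L ℕ.* L) L {{ℕ.m*n≢0 L L}}}}))))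
      ...   | yes 2E≤t = inj₂ (AllDilates.ring-small univ-unique dilate 2E≤t)
        where
        zero-quotient : Quotient 0#
        zero-quotient = quotient⁺ (B̄.⊆-original a₃∈) (B̄.⊆-original a₃∈) (B̄.⊆-original a₃∈) (B̄.⊆-original a₄∈) ne
          (trans (zeroʳ (a₃ - a₄)) (sym (-‿inverseʳ a₃)))
        successor : ∀ q → Quotient q → Quotient (1# + q)
        successor q Qq with quotient? (1# + q)
        ... | yes Q = Q
        ... | no ¬Q = contradiction (lose (univ-complete q) (Qq , ¬Q)) none
        predecessor : ∀ o ξ → o + (ξ - o) ≡ ξ
        predecessor = solve 2 (λ o ξ → o :+ (ξ :- o) := ξ) refl
        dilate : ∀ ξ → Dilate ξ
        -- Goodness is available for 1 plus a quotient, so `ξ` is reached from the quotient `ξ - 1`.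
        dilate ξ = subst Dilate (predecessor 1# ξ)
          (quotient-dilate-unscaled (generated Quotient zero-quotient successor (ξ - 1#)))

-- Explicit constants

open +-*-Solver using () renaming (solve to solveℕ; _:=_ to _:≡_; _:*_ to _⊛_; _:^_ to _⊛^_; con to conℕ)

stepGrowth-formula : ∀ L → stepGrowth L ≡ 128 ℕ.* L ℕ.^ 16
stepGrowth-formula = solveℕ 1 (λ L → let σ = conℕ 2 ⊛ (L ⊛ L) ⊛ (L ⊛ L) in
  σ ⊛ (σ ⊛ (conℕ 2 ⊛ (σ ⊛ (L ⊛ L)))) ⊛ (L ⊛ (conℕ 8 ⊛ L)) :≡ conℕ 128 ⊛ L ⊛^ 16) refl

-- Abstract, so that the type checker never unfolds powers with this exponent.
abstract
  dilateScale dilateExponent : ℕ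
  dilateScale = 128 ℕ.^ 6
  dilateExponent = 96

  dilateScale≢0 : ℕ.NonZero dilateScale
  dilateScale≢0 = ℕ.m^n≢0 128 6

  dilateGrowth-formula : ∀ L → dilateGrowth L ≡ dilateScale ℕ.* L ℕ.^ dilateExponent
  dilateGrowth-formula L = trans (sixth-power (stepGrowth L)) (trans (cong (ℕ._^ 6) (stepGrowth-formula L))
    (trans (distrib 128 (L ℕ.^ 16)) (cong (128 ℕ.^ 6 ℕ.*_) (ℕ.^-*-assoc L 16 6))))
    where
    sixth-power : ∀ k → k ℕ.* (k ℕ.* (k ℕ.* (k ℕ.* (k ℕ.* k)))) ≡ k ℕ.^ 6
    sixth-power = solveℕ 1 (λ k → k ⊛ (k ⊛ (k ⊛ (k ⊛ (k ⊛ k)))) :≡ k ⊛^ 6) refl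
    distrib : ∀ c x → (c ℕ.* x) ℕ.^ 6 ≡ c ℕ.^ 6 ℕ.* x ℕ.^ 6
    distrib = solveℕ 2 (λ c x → (c ⊛ x) ⊛^ 6 :≡ c ⊛^ 6 ⊛ x ⊛^ 6) refl

dilateGrowth>0 : ∀ L .{{_ : ℕ.NonZero L}} → 0 ℕ.< dilateGrowth L
dilateGrowth>0 L = subst (0 ℕ.<_) (sym (dilateGrowth-formula L))
  (ℕ.>-nonZero⁻¹ _ {{ℕ.m*n≢0 dilateScale (L ℕ.^ dilateExponent) {{dilateScale≢0}} {{ℕ.m^n≢0 L dilateExponent}}}})

-- The sum-product dichotomy over an abstract ring

module SumProduct {R : Set} {add mul : Op₂ R} {neg : Op₁ R} {0R 1R : R}
  (isCommutativeRing : IsCommutativeRing _≡_ add mul neg 0R 1R) (_≟_ : DecidableEquality R)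
  {F : Set} (_≟F_ : DecidableEquality F) (π : R → F)
  (π-shift : ∀ {a b} c → π a ≡ π b → π (add a c) ≡ π (add b c))
  (π-unit : ∀ {a b} → π a ≢ π b → UnitCancellation.Unit isCommutativeRing (add a (neg b))) where

  open Sumsets isCommutativeRing _≟_ using (ring)
  open UnitCancellation isCommutativeRing
  open Dilates isCommutativeRing _≟_
  open Residues isCommutativeRing _≟_ _≟F_ π π-shift π-unit
  open CommutativeRing ring using (_+_; _*_; _-_; 0#; 1#; +-identityʳ)
  open DifferenceSolver ring
  open DecMembership _≟_ using (_∈?_)
  open ℕ.≤-Reasoning

  module _ {univ : List R} (univ-unique : Unique univ) (univ-complete : ∀ x → x ∈ univ)
    (generated : (P : R → Set) → P 0# → (∀ x → P x → P (1# + x)) → ∀ x → P x)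
    {A V W : List R} {L : ℕ} (L>0 : 0 ℕ.< L) (A-unique : Unique A) (A-nonempty : 0 ℕ.< length A)
    (A+A⊆V : ∀ {a b} → a ∈ A → b ∈ A → a + b ∈ V) (V-small : length V ℕ.≤ L ℕ.* length A)
    (W-unique : Unique W)
    (A*A⊆W : ∀ {a b} → a ∈ A → b ∈ A → a * b ∈ W) (W-small : length W ℕ.≤ L ℕ.* length A)
    (T : Transversal π A) where

    private
      n t E : ℕ
      n = length A
      t = length (Transversal.members T)
      E = dilateGrowth L

      instance
        L≢0 : ℕ.NonZero L
        L≢0 = ℕ.>-nonZero L>0
        n≢0 : ℕ.NonZero n
        n≢0 = ℕ.>-nonZero A-nonempty

      U Z : List R
      U = filter (λ a → ¬? (π a ≟F π 0#)) A
      Z = filter (λ a → π a ≟F π 0#) A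

      ∈-U⁻ : ∀ {a} → a ∈ U → a ∈ A × Unit a
      ∈-U⁻ {a} p with a∈ , πa≢ ← ∈-filter⁻ (λ a → ¬? (π a ≟F π 0#)) {xs = A} p =
        a∈ , subst Unit (trans (sym (+-identityʳ _)) (lem a 0#)) (π-unit πa≢)
        where
        lem : ∀ a z → a - z + z ≡ a
        lem = solve 2 (λ a z → a :- z :+ z := a) refl

      -- The non-units all have residue 0, so `residues-bound` with one class gives |Z| t ≤ |V| ≤ L
      -- n, and `2 * L ≤ t` leaves them at most half of `A`.
      U-large : 2 ℕ.* L ℕ.≤ t → n ℕ.≤ 2 ℕ.* length U
      U-large 2L≤t = ℕ.+-cancelʳ-≤ n _ _ (begin
        n ℕ.+ n                                ≡⟨ cong (λ m → m ℕ.+ m) (length-filter-∁ (λ a → π a ≟F π 0#) A) ⟩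
        (length Z ℕ.+ length U) ℕ.+ (length Z ℕ.+ length U)   ≡⟨ lem (length Z) (length U) ⟩
        2 ℕ.* length U ℕ.+ 2 ℕ.* length Z      ≤⟨ ℕ.+-monoʳ-≤ (2 ℕ.* length U) 2Z≤n ⟩
        2 ℕ.* length U ℕ.+ n                   ∎)
        where
        lem : ∀ z u → (z ℕ.+ u) ℕ.+ (z ℕ.+ u) ≡ 2 ℕ.* u ℕ.+ 2 ℕ.* z
        lem = solve-∀
        lem₂ : ∀ L z → L ℕ.* (2 ℕ.* z) ≡ z ℕ.* (2 ℕ.* L)
        lem₂ = solve-∀
        2Z≤n : 2 ℕ.* length Z ℕ.≤ n
        2Z≤n = ℕ.*-cancelˡ-≤ L (begin
          L ℕ.* (2 ℕ.* length Z)   ≡⟨ lem₂ L (length Z) ⟩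
          length Z ℕ.* (2 ℕ.* L)   ≤⟨ ℕ.*-monoʳ-≤ (length Z) 2L≤t ⟩
          length Z ℕ.* t           ≤⟨ residues-bound T A+A⊆V {Q = 0# ∷ []} (Unique.filter⁺ _ A-unique)
                                        (λ p → proj₁ (∈-filter⁻ (λ a → π a ≟F π 0#) {xs = A} p))
                                        (λ p → 0# , here refl , proj₂ (∈-filter⁻ (λ a → π a ≟F π 0#) {xs = A} p)) ⟩
          1 ℕ.* length V           ≡⟨ ℕ.*-identityˡ (length V) ⟩
          length V                 ≤⟨ V-small ⟩
          L ℕ.* n                  ∎)

      product? : ∀ a v → Dec (v ∈ a · A)
      product? a v = v ∈? a · A

      regular : ∀ {a} → a ∈ U → count (product? a) W ≡ n
      regular {a} a∈U with a∈ , a-unit ← ∈-U⁻ a∈U = ℕ.≤-antisym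
        (ℕ.≤-trans (count-≤ (product? a) W-unique (λ _ p → p)) (ℕ.≤-reflexive (length-map (a *_) A)))
        (length-≤-by-injection (a *_) A-unique
          (λ x∈ → ∈-filter⁺ (product? a) (A*A⊆W a∈ x∈) (∈-map⁺ (a *_) x∈)) (λ _ _ → unit-cancel a-unit))

      E>0 : 0 ℕ.< E
      E>0 = dilateGrowth>0 L

      module Units (2L≤t : 2 ℕ.* L ℕ.≤ t) where

        U-nonempty : 0 ℕ.< length U
        U-nonempty = ℕ.*-cancelˡ-< 2 0 (length U) (ℕ.<-≤-trans A-nonempty (U-large 2L≤t))

        open CommonNeighbours product? {U} {W} W-unique U-nonempty A-nonempty L>0 regular W-small

        conclude : (∃[ b ] b ∈ U × length U ℕ.≤ 8 ℕ.* L ℕ.* length (popular (8 ℕ.* L) n (λ a → codegree a b) U)) →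
          t ℕ.≤ 256 ℕ.* (L ℕ.* L ℕ.* L) ℕ.* E ⊎ length univ ℕ.≤ 4 ℕ.* E ℕ.* n
        conclude (b , b∈U , B-many) = few-residues⊎dense univ-unique univ-complete generated
          where
          B : List R
          B = popular (8 ℕ.* L) n (λ a → codegree a b) U
          ∈-B⁻ : ∀ {a} → a ∈ B → a ∈ U × n ℕ.≤ 8 ℕ.* L ℕ.* codegree a b
          ∈-B⁻ = ∈-filter⁻ (λ a → n ℕ.≤? 8 ℕ.* L ℕ.* codegree a b) {xs = U}
          open Partner A-unique A-nonempty A+A⊆V V-small (proj₂ (∈-U⁻ b∈U)) L>0
          -- Each `v` in aA ∩ bA is matched to some `x` with `v = a * x`; no `x` serves two values,
          -- since it determines `v`.
          codegree≤common : ∀ a → codegree a b ℕ.≤ length (common a)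
          codegree≤common a = length-≤-by-relation (λ v x → v ≡ a * x) (Unique.filter⁺ _ W-unique)
            (λ {v} p → let _ , v∈aA , v∈bA = ∈-filter⁻ (λ v → product? a v ×-dec product? b v) {xs = W} p
                           x , x∈ , eq = ∈-map⁻ (a *_) v∈aA in
                       x , ∈-filter⁺ (λ x → a * x ∈? b · A) x∈ (subst (_∈ b · A) eq v∈bA) , eq)
            (λ _ _ eq eq' → trans eq (sym eq'))
          B-good : ∀ {a} → a ∈ B → Good a
          B-good {a} p = ℕ.≤-trans (proj₂ (∈-B⁻ p)) (ℕ.*-monoʳ-≤ (8 ℕ.* L) (codegree≤common a))
          -- A factor 2 is lost to the non-units and a factor `8 * L` to the choice of popular
          -- partners.
          B-large : n ℕ.≤ 16 ℕ.* L ℕ.* length B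
          B-large = begin
            n                                 ≤⟨ U-large 2L≤t ⟩
            2 ℕ.* length U                    ≤⟨ ℕ.*-monoʳ-≤ 2 B-many ⟩
            2 ℕ.* (8 ℕ.* L ℕ.* length B)      ≡⟨ lem L (length B) ⟩
            16 ℕ.* L ℕ.* length B             ∎
            where
            lem : ∀ L b → 2 ℕ.* (8 ℕ.* L ℕ.* b) ≡ 16 ℕ.* L ℕ.* b
            lem = solve-∀
          open Expansion T A+A⊆V L>0 E>0 A-unique A-nonempty V-small
            (Unique.filter⁺ _ (Unique.filter⁺ _ A-unique)) (λ p → proj₁ (∈-U⁻ (proj₁ (∈-B⁻ p)))) B-large
            (λ p₁ p₂ p₃ p₄ → quotient-dilate (B-good p₁) (B-good p₂) (B-good p₃) (B-good p₄))

    sum-product : t ℕ.≤ 256 ℕ.* (L ℕ.* L ℕ.* L) ℕ.* E ⊎ length univ ℕ.≤ 4 ℕ.* E ℕ.* n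
    sum-product with 2 ℕ.* L ℕ.≤? t
    ... | yes 2L≤t = Units.conclude 2L≤t (CommonNeighbours.popular-partner product? W-unique (Units.U-nonempty 2L≤t) A-nonempty L>0 regular W-small)
    ... | no 2L≰t = inj₁ (begin
      t                                  ≤⟨ ℕ.<⇒≤ (ℕ.≰⇒> 2L≰t) ⟩
      2 ℕ.* L                            ≤⟨ ℕ.*-monoˡ-≤ L (ℕ.≤ᵇ⇒≤ 2 256 _) ⟩
      256 ℕ.* L                          ≤⟨ ℕ.*-monoʳ-≤ 256 (ℕ.m≤n*m L (L ℕ.* L) {{ℕ.m*n≢0 L L}}) ⟩
      256 ℕ.* (L ℕ.* L ℕ.* L)            ≤⟨ ℕ.m≤m*n _ E {{ℕ.>-nonZero E>0}} ⟩
      256 ℕ.* (L ℕ.* L ℕ.* L) ℕ.* E      ∎)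

-- The ring ℤ/n

toList : ∀ {n} → Subset n → List (Fin n)
toList [] = []
toList (inside ∷ S) = zero ∷ map suc (toList S)
toList (outside ∷ S) = map suc (toList S)

length-toList : ∀ {n} (S : Subset n) → length (toList S) ≡ ∣ S ∣
length-toList [] = refl
length-toList (inside ∷ S) = cong suc (trans (length-map suc (toList S)) (length-toList S))
length-toList (outside ∷ S) = trans (length-map suc (toList S)) (length-toList S)

∈-toList⁺ : ∀ {n} {S : Subset n} {x} → x Subset.∈ S → x ∈ toList S
∈-toList⁺ {S = inside ∷ S} here = here refl
∈-toList⁺ {S = inside ∷ S} (there x∈) = there (∈-map⁺ suc (∈-toList⁺ x∈))
∈-toList⁺ {S = outside ∷ S} (there x∈) = ∈-map⁺ suc (∈-toList⁺ x∈)

∈-toList⁻ : ∀ {n} {S : Subset n} {x} → x ∈ toList S → x Subset.∈ S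
∈-toList⁻ {S = inside ∷ S} (here refl) = here
∈-toList⁻ {S = inside ∷ S} (there p) with _ , q , refl ← ∈-map⁻ suc p = there (∈-toList⁻ q)
∈-toList⁻ {S = outside ∷ S} p with _ , q , refl ← ∈-map⁻ suc p = there (∈-toList⁻ q)

toList-unique : ∀ {n} (S : Subset n) → Unique (toList S)
toList-unique [] = []
toList-unique (inside ∷ S) = All.tabulate (λ p eq → zero∉ p eq) ∷ Unique.map⁺ suc-injective (toList-unique S)
  where
  zero∉ : ∀ {x} → x ∈ map suc (toList S) → zero ≢ x
  zero∉ p refl with _ , _ , () ← ∈-map⁻ suc p
toList-unique (outside ∷ S) = Unique.map⁺ suc-injective (toList-unique S)

∈-tabulate⁺ : ∀ {n} {P : Fin n → Set} (P? : ∀ x → Dec (P x)) {x} → P x → x Subset.∈ tabulate (does ∘ P?)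
∈-tabulate⁺ P? {x} Px = lookup⇒[]= x _ (trans (lookup∘tabulate _ x) (dec-true (P? x) Px))

∈-tabulate⁻ : ∀ {n} {P : Fin n → Set} (P? : ∀ x → Dec (P x)) {x} → x Subset.∈ tabulate (does ∘ P?) → P x
∈-tabulate⁻ P? {x} x∈ with P? x in eq
... | yes Px = Px
... | no _ with () ← trans (sym (cong does eq)) (trans (sym (lookup∘tabulate (does ∘ P?) x)) ([]=⇒lookup x∈))

∈-image₂ : ∀ {n} (f : ℤ/ n → ℤ/ n → ℤ/ n) {A B : Subset n} {a b} →
  a Subset.∈ A → b Subset.∈ B → f a b Subset.∈ image₂ f A B
∈-image₂ f {A} {B} {a} {b} a∈ b∈ = ∈-tabulate⁺
  (λ c → anyᶠ? λ a → anyᶠ? λ b → (a ∈ˢ? A) ×-dec (b ∈ˢ? B) ×-dec (f a b ≟ᶠ c)) (a , b , a∈ , b∈ , refl)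

module ResidueRing (n : ℕ) .{{_ : ℕ.NonZero n}} where

  [_] : ℕ → ℤ/ n
  [ m ] = m mod n

  toℕ-[] : ∀ m → toℕ [ m ] ≡ m % n
  toℕ-[] m = toℕ-fromℕ< (m%n<n m n)

  []-cong : ∀ {l m} → l % n ≡ m % n → [ l ] ≡ [ m ]
  []-cong {l} {m} eq = toℕ-injective (trans (toℕ-[] l) (trans eq (sym (toℕ-[] m))))

  []-toℕ : ∀ a → [ toℕ a ] ≡ a
  []-toℕ a = toℕ-injective (trans (toℕ-[] (toℕ a)) (m<n⇒m%n≡m (toℕ<n a)))

  -- Every class is `[ m ]` for some natural `m`, so with `[]-+` and `[]-*` the ring laws descend
  -- from those of ℕ.
  []-elim : (P : ℤ/ n → Set) → (∀ m → P [ m ]) → ∀ a → P a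
  []-elim P f a = subst P ([]-toℕ a) (f (toℕ a))

  []-+ : ∀ l m → [ l ] +ᴿ [ m ] ≡ [ l ℕ.+ m ]
  []-+ l m = []-cong (trans (cong₂ (λ x y → (x ℕ.+ y) % n) (toℕ-[] l) (toℕ-[] m)) (sym (%-distribˡ-+ l m n)))

  []-* : ∀ l m → [ l ] *ᴿ [ m ] ≡ [ l ℕ.* m ]
  []-* l m = []-cong (trans (cong₂ (λ x y → (x ℕ.* y) % n) (toℕ-[] l) (toℕ-[] m)) (sym (%-distribˡ-* l m n)))

  infix 8 -ᴿ_
  -ᴿ_ : ℤ/ n → ℤ/ n
  -ᴿ a = [ n ℕ.∸ toℕ a ]

  +ᴿ-comm : ∀ a b → a +ᴿ b ≡ b +ᴿ a
  +ᴿ-comm a b = cong [_] (ℕ.+-comm (toℕ a) (toℕ b))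

  *ᴿ-comm : ∀ a b → a *ᴿ b ≡ b *ᴿ a
  *ᴿ-comm a b = cong [_] (ℕ.*-comm (toℕ a) (toℕ b))

  +ᴿ-assoc : ∀ a b c → (a +ᴿ b) +ᴿ c ≡ a +ᴿ (b +ᴿ c)
  +ᴿ-assoc = []-elim _ λ k → []-elim _ λ l → []-elim _ λ m → trans
    (trans (cong (_+ᴿ [ m ]) ([]-+ k l)) ([]-+ (k ℕ.+ l) m))
    (trans (cong [_] (ℕ.+-assoc k l m)) (sym (trans (cong ([ k ] +ᴿ_) ([]-+ l m)) ([]-+ k (l ℕ.+ m)))))

  *ᴿ-assoc : ∀ a b c → (a *ᴿ b) *ᴿ c ≡ a *ᴿ (b *ᴿ c)
  *ᴿ-assoc = []-elim _ λ k → []-elim _ λ l → []-elim _ λ m → trans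
    (trans (cong (_*ᴿ [ m ]) ([]-* k l)) ([]-* (k ℕ.* l) m))
    (trans (cong [_] (ℕ.*-assoc k l m)) (sym (trans (cong ([ k ] *ᴿ_) ([]-* l m)) ([]-* k (l ℕ.* m)))))

  *ᴿ-distribˡ : ∀ a b c → a *ᴿ (b +ᴿ c) ≡ (a *ᴿ b) +ᴿ (a *ᴿ c)
  *ᴿ-distribˡ = []-elim _ λ k → []-elim _ λ l → []-elim _ λ m → trans
    (trans (cong ([ k ] *ᴿ_) ([]-+ l m)) ([]-* k (l ℕ.+ m)))
    (trans (cong [_] (ℕ.*-distribˡ-+ k l m)) (sym (trans (cong₂ _+ᴿ_ ([]-* k l) ([]-* k m)) ([]-+ (k ℕ.* l) (k ℕ.* m)))))

  *ᴿ-distribʳ : ∀ a b c → (b +ᴿ c) *ᴿ a ≡ (b *ᴿ a) +ᴿ (c *ᴿ a)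
  *ᴿ-distribʳ a b c = trans (*ᴿ-comm (b +ᴿ c) a) (trans (*ᴿ-distribˡ a b c) (cong₂ _+ᴿ_ (*ᴿ-comm a b) (*ᴿ-comm a c)))

  +ᴿ-identityˡ : ∀ a → [ 0 ] +ᴿ a ≡ a
  +ᴿ-identityˡ = []-elim _ (λ m → []-+ 0 m)

  *ᴿ-identityˡ : ∀ a → [ 1 ] *ᴿ a ≡ a
  *ᴿ-identityˡ = []-elim _ (λ m → trans ([]-* 1 m) (cong [_] (ℕ.*-identityˡ m)))

  [n]≡0 : [ n ] ≡ [ 0 ]
  [n]≡0 = []-cong (trans (n%n≡0 n) (sym (m<n⇒m%n≡m (ℕ.>-nonZero⁻¹ n))))

  -ᴿ-inverseʳ : ∀ a → a +ᴿ -ᴿ a ≡ [ 0 ]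
  -ᴿ-inverseʳ a = trans (cong (_+ᴿ -ᴿ a) (sym ([]-toℕ a)))
    (trans ([]-+ (toℕ a) (n ℕ.∸ toℕ a)) (trans (cong [_] (ℕ.m+[n∸m]≡n (ℕ.<⇒≤ (toℕ<n a)))) [n]≡0))

  isCommutativeRing : IsCommutativeRing _≡_ _+ᴿ_ _*ᴿ_ -ᴿ_ [ 0 ] [ 1 ]
  isCommutativeRing = record
    { isRing = record
      { +-isAbelianGroup = record
        { isGroup = record
          { isMonoid = record
            { isSemigroup = record
              { isMagma = record { isEquivalence = isEquivalence ; ∙-cong = cong₂ _+ᴿ_ }
              ; assoc = +ᴿ-assoc }
            ; identity = +ᴿ-identityˡ , λ a → trans (+ᴿ-comm a [ 0 ]) (+ᴿ-identityˡ a) }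
          ; inverse = (λ a → trans (+ᴿ-comm (-ᴿ a) a) (-ᴿ-inverseʳ a)) , -ᴿ-inverseʳ
          ; ⁻¹-cong = cong -ᴿ_ }
        ; comm = +ᴿ-comm }
      ; *-cong = cong₂ _*ᴿ_
      ; *-assoc = *ᴿ-assoc
      ; *-identity = *ᴿ-identityˡ , λ a → trans (*ᴿ-comm a [ 1 ]) (*ᴿ-identityˡ a)
      ; distrib = *ᴿ-distribˡ , *ᴿ-distribʳ }
    ; *-comm = *ᴿ-comm }

  generated-by-1 : (P : ℤ/ n → Set) → P [ 0 ] → (∀ x → P x → P ([ 1 ] +ᴿ x)) → ∀ x → P x
  generated-by-1 P base step = []-elim P go
    where
    go : ∀ m → P [ m ]
    go zero = base
    go (suc m) = subst P ([]-+ 1 m) (step [ m ] (go m))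

  commutativeRing : CommutativeRing 0ℓ 0ℓ
  commutativeRing = record { isCommutativeRing = isCommutativeRing }

  open DifferenceSolver commutativeRing using (solve; _:=_; _:+_; _:*_; _:-_; :-_)
  open UnitCancellation isCommutativeRing using (Unit)

  coprime⇒unit : ∀ d → Coprime (toℕ d) n → Unit d
  coprime⇒unit d coprime with coprime-Bézout coprime
  ... | Bézout.+- x y eq = [ x ] , (begin
    [ x ] *ᴿ d              ≡⟨ cong ([ x ] *ᴿ_) ([]-toℕ d) ⟨
    [ x ] *ᴿ [ toℕ d ]      ≡⟨ []-* x (toℕ d) ⟩
    [ x ℕ.* toℕ d ]         ≡⟨ cong [_] (sym eq) ⟩
    [ 1 ℕ.+ y ℕ.* n ]       ≡⟨ []-+ 1 (y ℕ.* n) ⟨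
    [ 1 ] +ᴿ [ y ℕ.* n ]    ≡⟨ cong ([ 1 ] +ᴿ_) ([]-cong (trans (m*n%n≡0 y n) (sym (m<n⇒m%n≡m (ℕ.>-nonZero⁻¹ n))))) ⟩
    [ 1 ] +ᴿ [ 0 ]          ≡⟨ []-+ 1 0 ⟩
    [ 1 ]                   ∎)
    where open ≡-Reasoning
  -- Here the identity is 1 + x d = y n over the naturals, hence the inverse is - x.
  ... | Bézout.-+ x y eq = -ᴿ [ x ] , (begin
    -ᴿ [ x ] *ᴿ d                                 ≡⟨ cancel [ 1 ] [ x ] d ⟩
    [ 1 ] +ᴿ -ᴿ ([ 1 ] +ᴿ [ x ] *ᴿ d)             ≡⟨ cong (λ z → [ 1 ] +ᴿ -ᴿ z) 1+xd≡0 ⟩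
    [ 1 ] +ᴿ -ᴿ [ 0 ]                             ≡⟨ cong ([ 1 ] +ᴿ_) -0≡0 ⟩
    [ 1 ] +ᴿ [ 0 ]                                ≡⟨ []-+ 1 0 ⟩
    [ 1 ]                                         ∎)
    where
    open ≡-Reasoning
    cancel : ∀ o x d → (-ᴿ x) *ᴿ d ≡ o +ᴿ -ᴿ (o +ᴿ x *ᴿ d)
    cancel = solve 3 (λ o x d → (:- x) :* d := o :- (o :+ x :* d)) refl
    -0≡0 : -ᴿ [ 0 ] ≡ [ 0 ]
    -0≡0 = trans (sym (+ᴿ-identityˡ (-ᴿ [ 0 ]))) (-ᴿ-inverseʳ [ 0 ])
    1+xd≡0 : [ 1 ] +ᴿ [ x ] *ᴿ d ≡ [ 0 ]
    1+xd≡0 = begin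
      [ 1 ] +ᴿ [ x ] *ᴿ d             ≡⟨ cong (λ z → [ 1 ] +ᴿ [ x ] *ᴿ z) ([]-toℕ d) ⟨
      [ 1 ] +ᴿ [ x ] *ᴿ [ toℕ d ]     ≡⟨ cong ([ 1 ] +ᴿ_) ([]-* x (toℕ d)) ⟩
      [ 1 ] +ᴿ [ x ℕ.* toℕ d ]        ≡⟨ []-+ 1 (x ℕ.* toℕ d) ⟩
      [ 1 ℕ.+ x ℕ.* toℕ d ]           ≡⟨ cong [_] eq ⟩
      [ y ℕ.* n ]                     ≡⟨ []-cong (trans (m*n%n≡0 y n) (sym (m<n⇒m%n≡m (ℕ.>-nonZero⁻¹ n)))) ⟩
      [ 0 ]                           ∎

  module Reduction (p : ℕ) .{{_ : ℕ.NonZero p}} (p∣n : p ∣ n) where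

    π : ℤ/ n → ℕ
    π a = toℕ a % p

    π-[] : ∀ m → π [ m ] ≡ m % p
    π-[] m = trans (cong (_% p) (toℕ-[] m)) (m∣n⇒o%n%m≡o%m p n m p∣n)

    π-shift : ∀ {a b} c → π a ≡ π b → π (a +ᴿ c) ≡ π (b +ᴿ c)
    π-shift {a} {b} c eq = trans (π-+ a c) (trans (cong (λ x → (x ℕ.+ π c) % p) eq) (sym (π-+ b c)))
      where
      π-+ : ∀ a c → π (a +ᴿ c) ≡ (π a ℕ.+ π c) % p
      π-+ a c = trans (π-[] (toℕ a ℕ.+ toℕ c)) (%-distribˡ-+ (toℕ a) (toℕ c) p)

    sub-add : ∀ a b → (a +ᴿ -ᴿ b) +ᴿ b ≡ a
    sub-add = solve 2 (λ a b → (a :- b) :+ b := a) refl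

    π-zero : ∀ {a} → π a ≡ π [ 0 ] → p ∣ toℕ a
    π-zero {a} eq = m%n≡0⇒n∣m (toℕ a) p (trans eq (trans (π-[] 0) (m<n⇒m%n≡m (ℕ.>-nonZero⁻¹ p))))

    ∣-sub⇒π≡ : ∀ {a b} → p ∣ toℕ (a +ᴿ -ᴿ b) → π a ≡ π b
    ∣-sub⇒π≡ {a} {b} p∣ = trans (cong π (sym (sub-add a b)))
      (trans (π-shift b (trans (n∣m⇒m%n≡0 _ p p∣) (sym (trans (π-[] 0) (m<n⇒m%n≡m (ℕ.>-nonZero⁻¹ p)))))) (cong π (+ᴿ-identityˡ b)))

    π≡⇒∣-sub : ∀ {a b} → π a ≡ π b → p ∣ toℕ (a +ᴿ -ᴿ b)
    π≡⇒∣-sub {a} {b} eq = π-zero (trans (π-shift (-ᴿ b) eq) (cong π (-ᴿ-inverseʳ b)))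

    ∈-p·R : ∀ {a} → p ∣ toℕ a → a Subset.∈ p ·R
    ∈-p·R {a} (divides q eq) = ∈-tabulate⁺ (λ c → anyᶠ? λ r → p ·ᴿ r ≟ᶠ c) ([ q ] , (begin
      [ p ℕ.* toℕ [ q ] ]           ≡⟨ []-cong p*q ⟩
      [ p ℕ.* q ]                   ≡⟨ cong [_] (trans (ℕ.*-comm p q) (sym eq)) ⟩
      [ toℕ a ]                     ≡⟨ []-toℕ a ⟩
      a                             ∎))
      where
      open ≡-Reasoning
      p*q : (p ℕ.* toℕ [ q ]) % n ≡ (p ℕ.* q) % n
      p*q = begin
        (p ℕ.* toℕ [ q ]) % n              ≡⟨ cong (λ x → (p ℕ.* x) % n) (toℕ-[] q) ⟩
        (p ℕ.* (q % n)) % n                ≡⟨ %-distribˡ-* p (q % n) n ⟩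
        ((p % n) ℕ.* (q % n % n)) % n      ≡⟨ cong (λ x → ((p % n) ℕ.* x) % n) (m%n%n≡m%n q n) ⟩
        ((p % n) ℕ.* (q % n)) % n          ≡⟨ %-distribˡ-* p q n ⟨
        (p ℕ.* q) % n                      ∎

-- Coprimality with prime powers

coprime-* : ∀ {x y m} → Coprime x m → Coprime y m → Coprime (x ℕ.* y) m
coprime-* {x} {y} cx cy {d} (d∣xy , d∣m) = cy (coprime-divisor d-coprime-x d∣xy , d∣m)
  where
  d-coprime-x : Coprime d x
  d-coprime-x (e∣d , e∣x) = cx (e∣x , ∣-trans e∣d d∣m)

coprime-^ : ∀ {x m} k → Coprime x m → Coprime (x ℕ.^ k) m
coprime-^ zero c (d∣1 , _) = ∣1⇒≡1 d∣1
coprime-^ (suc k) c = coprime-* c (coprime-^ k c)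

prime∤⇒coprime : ∀ {p m} → Prime p → ¬ p ∣ m → Coprime p m
prime∤⇒coprime p-prime p∤m (d∣p , d∣m) with prime⇒irreducible p-prime d∣p
... | inj₁ d≡1 = d≡1
... | inj₂ refl = contradiction d∣m p∤m

-- Natural powers over the rationals

open import Data.Fin.Subset using (Subset; Nonempty; _⊆_; ∣_∣; ⊤)
open import Data.Nat as ℕ using (ℕ; _^_)
open import Data.Nat.Primality using (Prime)
open import Data.Product using (_×_; ∃-syntax)
open import Data.Rational using (ℚ; 1ℚ; _≤_; _*_)
open import Data.Sum using (_⊎_)
open import Data.Integer as ℤ using (+_; -[1+_])
open import Data.Rational as ℚ using (mkℚ; *≤*; NonNegative; Positive; 1/_)
import Data.Rational.Properties as ℚ

-- The division in `fromℕ` normalises by a gcd, which is stuck on a variable `m`; the constructor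
-- form computes.
fromℕ≡mkℚ : ∀ m → fromℕ m ≡ mkℚ (+ m) 0 (coprime-sym (1-coprimeTo m))
fromℕ≡mkℚ m = ℚ.normalize-coprime (coprime-sym (1-coprimeTo m))

fromℕ-* : ∀ l m → fromℕ (l ℕ.* m) ≡ fromℕ l * fromℕ m
fromℕ-* l m = sym (trans (cong₂ _*_ (fromℕ≡mkℚ l) (fromℕ≡mkℚ m)) (cong (λ i → i ℚ./ 1) (sym (ℤ.pos-* l m))))

fromℕ-mono : ∀ {l m} → l ℕ.≤ m → fromℕ l ≤ fromℕ m
fromℕ-mono {l} {m} l≤m = subst₂ _≤_ (sym (fromℕ≡mkℚ l)) (sym (fromℕ≡mkℚ m))
  (*≤* (ℤ.*-monoʳ-≤-nonNeg (+ 1) (ℤ.+≤+ l≤m)))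

fromℕ-reflects : ∀ {l m} → fromℕ l ≤ fromℕ m → l ℕ.≤ m
fromℕ-reflects {l} {m} le with *≤* l≤m ← subst₂ _≤_ (fromℕ≡mkℚ l) (fromℕ≡mkℚ m) le =
  ℤ.drop‿+≤+ (ℤ.*-cancelʳ-≤-pos (+ l) (+ m) (+ 1) l≤m)

fromℕ-nonNeg : ∀ m → NonNegative (fromℕ m)
fromℕ-nonNeg m = ℚ.normalize-nonNeg m 1

^ℚ-nonNeg : ∀ x .{{_ : NonNegative x}} e → NonNegative (x ^ℚ e)
^ℚ-nonNeg x zero = _
^ℚ-nonNeg x (suc e) = ℚ.nonNeg*nonNeg⇒nonNeg x (x ^ℚ e) {{^ℚ-nonNeg x e}}

*-mono-≤-nonNeg : ∀ {w x y z} .{{_ : NonNegative x}} .{{_ : NonNegative y}} → w ≤ x → y ≤ z → w * y ≤ x * z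
*-mono-≤-nonNeg {x = x} {y} w≤x y≤z = ℚ.≤-trans (ℚ.*-monoʳ-≤-nonNeg y w≤x) (ℚ.*-monoˡ-≤-nonNeg x y≤z)

^ℚ-mono : ∀ {x y} .{{_ : NonNegative x}} .{{_ : NonNegative y}} e → x ≤ y → x ^ℚ e ≤ y ^ℚ e
^ℚ-mono zero x≤y = ℚ.≤-refl
^ℚ-mono {x} {y} {{_}} {{y≥0}} (suc e) x≤y = *-mono-≤-nonNeg {{y≥0}} {{^ℚ-nonNeg x e}} x≤y (^ℚ-mono e x≤y)

interchange : ∀ w x y z → (w * x) * (y * z) ≡ (w * y) * (x * z)
interchange w x y z = begin
  (w * x) * (y * z)  ≡⟨ ℚ.*-assoc w x (y * z) ⟩
  w * (x * (y * z))  ≡⟨ cong (w *_) (sym (ℚ.*-assoc x y z)) ⟩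
  w * ((x * y) * z)  ≡⟨ cong (λ v → w * (v * z)) (ℚ.*-comm x y) ⟩
  w * ((y * x) * z)  ≡⟨ cong (w *_) (ℚ.*-assoc y x z) ⟩
  w * (y * (x * z))  ≡⟨ ℚ.*-assoc w y (x * z) ⟨
  (w * y) * (x * z)  ∎
  where open ≡-Reasoning

^ℚ-distrib-* : ∀ x y e → (x * y) ^ℚ e ≡ x ^ℚ e * y ^ℚ e
^ℚ-distrib-* x y zero = refl
^ℚ-distrib-* x y (suc e) = trans (cong ((x * y) *_) (^ℚ-distrib-* x y e)) (interchange x y (x ^ℚ e) (y ^ℚ e))

1^ℚ : ∀ e → 1ℚ ^ℚ e ≡ 1ℚ
1^ℚ zero = refl
1^ℚ (suc e) = trans (ℚ.*-identityˡ _) (1^ℚ e)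

fromℕ-^ : ∀ m e → fromℕ (m ^ e) ≡ fromℕ m ^ℚ e
fromℕ-^ m zero = refl
fromℕ-^ m (suc e) = trans (fromℕ-* m (m ^ e)) (cong (fromℕ m *_) (fromℕ-^ m e))

fromℕ-suc : ∀ m → fromℕ (suc m) ≡ 1ℚ ℚ.+ fromℕ m
fromℕ-suc m = sym (trans (cong (1ℚ ℚ.+_) (fromℕ≡mkℚ m)) (cong (λ i → (+ 1 ℤ.+ i) ℚ./ 1) (ℤ.*-identityʳ (+ m))))

module _ {K : ℚ} (1≤K : 1ℚ ≤ K) where

  private
    instance
      K>0 : Positive K
      K>0 = ℚ.positive (ℚ.<-≤-trans (ℚ.positive⁻¹ 1ℚ) 1≤K)
      K≥0 : NonNegative K
      K≥0 = ℚ.pos⇒nonNeg K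

  ^ℚ-monoʳ : ∀ {d e} → d ℕ.≤ e → K ^ℚ d ≤ K ^ℚ e
  ^ℚ-monoʳ {e = zero} z≤n = ℚ.≤-refl
  ^ℚ-monoʳ {e = suc e} z≤n = subst (_≤ K ^ℚ suc e) (ℚ.*-identityˡ 1ℚ)
    (*-mono-≤-nonNeg 1≤K (^ℚ-monoʳ {e = e} z≤n))
  ^ℚ-monoʳ {suc d} {suc e} (s≤s d≤e) = ℚ.*-monoˡ-≤-nonNeg K (^ℚ-monoʳ d≤e)

  -- The floor of `K` plus 1 is at least `K`, and at most K + 1 ≤ 2K because 1 ≤ K.
  natural-above : ∃[ L ] 0 ℕ.< L × K ≤ fromℕ L × fromℕ L ≤ fromℕ 2 * K
  natural-above = go K 1≤K
    where
    go : ∀ K → 1ℚ ≤ K → ∃[ L ] 0 ℕ.< L × K ≤ fromℕ L × fromℕ L ≤ fromℕ 2 * K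
    go (mkℚ -[1+ _ ] _ _) (*≤* ())
    go K@(mkℚ (+ m) d-1 c) 1≤K = suc q , s≤s z≤n
      , subst (K ≤_) (sym (fromℕ≡mkℚ (suc q))) (*≤* (subst₂ ℤ._≤_ (ℤ.pos-* m 1) (ℤ.pos-* (suc q) d) (ℤ.+≤+ above)))
      , (begin
          fromℕ (suc q)    ≡⟨ fromℕ-suc q ⟩
          1ℚ ℚ.+ fromℕ q   ≤⟨ ℚ.+-mono-≤ 1≤K (subst (_≤ K) (sym (fromℕ≡mkℚ q)) (*≤* (subst₂ ℤ._≤_ (ℤ.pos-* q d) (ℤ.pos-* m 1) (ℤ.+≤+ below)))) ⟩
          K ℚ.+ K          ≡⟨ cong₂ ℚ._+_ (sym (ℚ.*-identityˡ K)) (sym (ℚ.*-identityˡ K)) ⟩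
          1ℚ * K ℚ.+ 1ℚ * K  ≡⟨ ℚ.*-distribʳ-+ K 1ℚ 1ℚ ⟨
          fromℕ 2 * K      ∎)
      where
      open ℚ.≤-Reasoning
      d = suc d-1
      q = m ℕ./ d
      below : q ℕ.* d ℕ.≤ m ℕ.* 1
      below = ℕ.≤-trans (m/n*n≤m m d) (ℕ.≤-reflexive (sym (ℕ.*-identityʳ m)))
      above : m ℕ.* 1 ℕ.≤ suc q ℕ.* d
      above = ℕ.≤-trans (ℕ.≤-reflexive (trans (ℕ.*-identityʳ m) (m≡m%n+[m/n]*n m d)))
        (ℕ.+-monoˡ-≤ (q ℕ.* d) (ℕ.<⇒≤ (m%n<n m d)))

  -- Returns from the natural `L` to the rational `K`; replacing `L` by 2K costs the factor `2 ^ e`.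
  power-bound : ∀ {L m c e n} → fromℕ L ≤ fromℕ 2 * K → m ℕ.≤ c ℕ.* L ^ e ℕ.* n →
    fromℕ m ≤ fromℕ (c ℕ.* 2 ^ e) * K ^ℚ e * fromℕ n
  power-bound {L} {m} {c} {e} {n} L≤2K m≤ = begin
    fromℕ m                                        ≤⟨ fromℕ-mono m≤ ⟩
    fromℕ (c ℕ.* L ^ e ℕ.* n)                      ≡⟨ fromℕ-* (c ℕ.* L ^ e) n ⟩
    fromℕ (c ℕ.* L ^ e) * fromℕ n                  ≤⟨ ℚ.*-monoʳ-≤-nonNeg (fromℕ n) {{fromℕ-nonNeg n}} step ⟩
    fromℕ (c ℕ.* 2 ^ e) * K ^ℚ e * fromℕ n         ∎
    where
    open ℚ.≤-Reasoning
    instance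
      2K≥0 : NonNegative (fromℕ 2 * K)
      2K≥0 = ℚ.nonNeg*nonNeg⇒nonNeg (fromℕ 2) K
    step : fromℕ (c ℕ.* L ^ e) ≤ fromℕ (c ℕ.* 2 ^ e) * K ^ℚ e
    step = begin
      fromℕ (c ℕ.* L ^ e)                    ≡⟨ trans (fromℕ-* c (L ^ e)) (cong (fromℕ c *_) (fromℕ-^ L e)) ⟩
      fromℕ c * fromℕ L ^ℚ e                 ≤⟨ ℚ.*-monoˡ-≤-nonNeg (fromℕ c) {{fromℕ-nonNeg c}} (^ℚ-mono {{fromℕ-nonNeg L}} e L≤2K) ⟩
      fromℕ c * (fromℕ 2 * K) ^ℚ e           ≡⟨ cong (fromℕ c *_) (^ℚ-distrib-* (fromℕ 2) K e) ⟩
      fromℕ c * (fromℕ 2 ^ℚ e * K ^ℚ e)      ≡⟨ cong (λ z → fromℕ c * (z * K ^ℚ e)) (fromℕ-^ 2 e) ⟨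
      fromℕ c * (fromℕ (2 ^ e) * K ^ℚ e)     ≡⟨ ℚ.*-assoc (fromℕ c) (fromℕ (2 ^ e)) (K ^ℚ e) ⟨
      fromℕ c * fromℕ (2 ^ e) * K ^ℚ e       ≡⟨ cong (_* K ^ℚ e) (fromℕ-* c (2 ^ e)) ⟨
      fromℕ (c ℕ.* 2 ^ e) * K ^ℚ e           ∎

  inverse-nonNeg : NonNegative (inverse K 1≤K)
  inverse-nonNeg = ℚ.pos⇒nonNeg (inverse K 1≤K) {{ℚ.1/pos⇒pos K}}

  divide-power : ∀ {x y D} e → x ≤ D * K ^ℚ e * y → inverse K 1≤K ^ℚ e * x ≤ D * y
  divide-power {x} {y} {D} e x≤ = begin
    I ^ℚ e * x                        ≤⟨ ℚ.*-monoˡ-≤-nonNeg (I ^ℚ e) {{^ℚ-nonNeg I {{inverse-nonNeg}} e}} x≤ ⟩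
    I ^ℚ e * (D * K ^ℚ e * y)         ≡⟨ cong (λ z → I ^ℚ e * (z * y)) (ℚ.*-comm D (K ^ℚ e)) ⟩
    I ^ℚ e * (K ^ℚ e * D * y)         ≡⟨ cong (I ^ℚ e *_) (ℚ.*-assoc (K ^ℚ e) D y) ⟩
    I ^ℚ e * (K ^ℚ e * (D * y))       ≡⟨ ℚ.*-assoc (I ^ℚ e) (K ^ℚ e) (D * y) ⟨
    I ^ℚ e * K ^ℚ e * (D * y)         ≡⟨ cong (_* (D * y)) (trans (sym (^ℚ-distrib-* I K e)) (trans (cong (_^ℚ e) (ℚ.*-inverseˡ K {{K≢0}})) (1^ℚ e))) ⟩
    1ℚ * (D * y)                      ≡⟨ ℚ.*-identityˡ (D * y) ⟩
    D * y                             ∎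
    where
    open ℚ.≤-Reasoning
    I = inverse K 1≤K
    K≢0 : ℚ.NonZero K
    K≢0 = ℚ.pos⇒nonZero K

-- Units and cosets in ℤ/p^k

module PrimePower {p k : ℕ} (p-prime : Prime p) (1≤k : 1 ℕ.≤ k) where

  instance
    p≢0 : ℕ.NonZero p
    p≢0 = prime⇒nonZero p-prime
    p^k≢0 : ℕ.NonZero (p ^ k)
    p^k≢0 = ℕ.m^n≢0 p k

  private
    p∣p^k : ∀ k → 1 ℕ.≤ k → p ∣ p ^ k
    p∣p^k (suc k) _ = m∣m*n (p ^ k)

  open ResidueRing (p ^ k)
  open Reduction p (p∣p^k k 1≤k)
  open DecMembership (_≟ᶠ_ {n = p ^ k}) using () renaming (_∈?_ to _∈ᴸ?_)

  -- Different residues mean that `p` does not divide the difference, which is then coprime to `p`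
  -- and so to `p ^ k`.
  π-unit : ∀ {a b} → π a ≢ π b → UnitCancellation.Unit isCommutativeRing (a +ᴿ -ᴿ b)
  π-unit {a} {b} πa≢ = coprime⇒unit (a +ᴿ -ᴿ b)
    (coprime-sym (coprime-^ k (prime∤⇒coprime p-prime λ p∣ → πa≢ (∣-sub⇒π≡ p∣))))

  module _ {A : Subset (p ^ k)} (A-nonempty : Nonempty A) where

    representatives : Transversal π (toList A)
    representatives = transversal ℕ._≟_ π (toList A)

    open Transversal representatives

    cosetReps : Subset (p ^ k)
    cosetReps = tabulate (does ∘ (_∈ᴸ? members))

    ∣cosetReps∣≤ : ∣ cosetReps ∣ ℕ.≤ length members
    ∣cosetReps∣≤ = subst (ℕ._≤ length members) (length-toList cosetReps)
      (length-≤-by-injection id (toList-unique cosetReps) (λ x∈ → ∈-tabulate⁻ (_∈ᴸ? members) (∈-toList⁻ x∈)) (λ _ _ eq → eq))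

    cosetReps-nonempty : Nonempty cosetReps
    cosetReps-nonempty =
      let t , t∈ , _ = represented (∈-toList⁺ (proj₂ A-nonempty)) in t , ∈-tabulate⁺ (_∈ᴸ? members) t∈

    A⊆p·R+cosetReps : A ⊆ p ·R +ˢ cosetReps
    A⊆p·R+cosetReps {a} a∈ with t , t∈ , πa≡πt ← represented (∈-toList⁺ a∈) =
      subst (Subset._∈ p ·R +ˢ cosetReps) (sub-add a t)
        (∈-image₂ _+ᴿ_ {p ·R} {cosetReps} (∈-p·R (π≡⇒∣-sub πa≡πt)) (∈-tabulate⁺ (_∈ᴸ? members) t∈))

    few-residues⊎dense : ∀ {L} → 0 ℕ.< L → ∣ A +ˢ A ∣ ℕ.≤ L ℕ.* ∣ A ∣ → ∣ A *ˢ A ∣ ℕ.≤ L ℕ.* ∣ A ∣ →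
      length members ℕ.≤ 256 ℕ.* (L ℕ.* L ℕ.* L) ℕ.* dilateGrowth L
        ⊎ p ^ k ℕ.≤ 4 ℕ.* dilateGrowth L ℕ.* ∣ A ∣
    few-residues⊎dense {L} L>0 sum≤ prod≤ = subst₂ (λ N n → length members ℕ.≤ 256 ℕ.* (L ℕ.* L ℕ.* L) ℕ.* dilateGrowth L ⊎ N ℕ.≤ 4 ℕ.* dilateGrowth L ℕ.* n)
      (length-tabulate id) (length-toList A)
      (SumProduct.sum-product isCommutativeRing _≟ᶠ_ ℕ._≟_ π π-shift π-unit (allFin⁺ (p ^ k)) ∈-allFin generated-by-1
        {A = toList A} {V = toList (A +ˢ A)} {W = toList (A *ˢ A)} L>0 (toList-unique A) nonempty
        (λ a∈ b∈ → ∈-toList⁺ (∈-image₂ _+ᴿ_ {A} {A} (∈-toList⁻ a∈) (∈-toList⁻ b∈))) (to-length (A +ˢ A) sum≤)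
        (toList-unique (A *ˢ A))
        (λ a∈ b∈ → ∈-toList⁺ (∈-image₂ _*ᴿ_ {A} {A} (∈-toList⁻ a∈) (∈-toList⁻ b∈))) (to-length (A *ˢ A) prod≤)
        representatives)
      where
      to-length : ∀ S → ∣ S ∣ ℕ.≤ L ℕ.* ∣ A ∣ → length (toList S) ℕ.≤ L ℕ.* length (toList A)
      to-length S = subst₂ (λ s n → s ℕ.≤ L ℕ.* n) (sym (length-toList S)) (sym (length-toList A))
      nonempty : 0 ℕ.< length (toList A)
      nonempty with x ∷ _ ← toList A | p ← ∈-toList⁺ (proj₂ A-nonempty) = s≤s z≤n

-- The constants are variables tied to `dilateGrowth` by equations, which keeps concrete powers out
-- of the goals. `C` dominates both the factor and the exponent of the covering bound; raising the
-- exponent from `e` to `C` is allowed because 1 ≤ K.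
bounded-covering⊎dense : ∀ {c d e m C} →
  (∀ L → 256 ℕ.* (L ℕ.* L ℕ.* L) ℕ.* dilateGrowth L ≡ c ℕ.* L ^ e) →
  (∀ L → 4 ℕ.* dilateGrowth L ≡ d ℕ.* L ^ m) →
  c ℕ.* 2 ^ e ℕ.≤ C → e ℕ.≤ C →
  (p k : ℕ) → Prime p → 1 ℕ.≤ k →
  (A : Subset (p ^ k)) → Nonempty A →
  (K : ℚ) (1≤K : 1ℚ ≤ K) →
  fromℕ ∣ A +ˢ A ∣ ≤ K * fromℕ ∣ A ∣ →
  fromℕ ∣ A *ˢ A ∣ ≤ K * fromℕ ∣ A ∣ →
  (∃[ X ] (Nonempty X × fromℕ ∣ X ∣ ≤ fromℕ C * K ^ℚ C × A ⊆ p ·R +ˢ X))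
  ⊎ inverse K 1≤K ^ℚ m * fromℕ ∣ ⊤ {p ^ k} ∣ ≤ fromℕ (d ℕ.* 2 ^ m) * fromℕ ∣ A ∣
bounded-covering⊎dense {c} {d} {e} {m} {C} covering density c2^e≤C e≤C p k p-prime 1≤k A A-nonempty K 1≤K sum≤ prod≤ =
  conclude (natural-above 1≤K)
  where
  open PrimePower p-prime 1≤k
  open ℚ.≤-Reasoning

  natural-doubling : ∀ {L s} → K ≤ fromℕ L → fromℕ s ≤ K * fromℕ ∣ A ∣ → s ℕ.≤ L ℕ.* ∣ A ∣
  natural-doubling {L} {s} K≤L s≤ = fromℕ-reflects {s} {L ℕ.* ∣ A ∣} (ℚ.≤-trans s≤
    (subst (K * fromℕ ∣ A ∣ ≤_) (sym (fromℕ-* L ∣ A ∣)) (ℚ.*-monoʳ-≤-nonNeg (fromℕ ∣ A ∣) {{fromℕ-nonNeg ∣ A ∣}} K≤L)))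

  K≥0 : ℚ.NonNegative K
  K≥0 = ℚ.nonNegative (ℚ.≤-trans (ℚ.nonNegative⁻¹ 1ℚ) 1≤K)

  conclude : ∃[ L ] 0 ℕ.< L × K ≤ fromℕ L × fromℕ L ≤ fromℕ 2 * K →
    (∃[ X ] (Nonempty X × fromℕ ∣ X ∣ ≤ fromℕ C * K ^ℚ C × A ⊆ p ·R +ˢ X))
    ⊎ inverse K 1≤K ^ℚ m * fromℕ ∣ ⊤ {p ^ k} ∣ ≤ fromℕ (d ℕ.* 2 ^ m) * fromℕ ∣ A ∣
  conclude (L , L>0 , K≤L , L≤2K) = Sum.map few dense
    (few-residues⊎dense A-nonempty L>0 (natural-doubling {L} {∣ A +ˢ A ∣} K≤L sum≤) (natural-doubling {L} {∣ A *ˢ A ∣} K≤L prod≤))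
    where
    few : length (Transversal.members (representatives A-nonempty)) ℕ.≤ 256 ℕ.* (L ℕ.* L ℕ.* L) ℕ.* dilateGrowth L →
      ∃[ X ] (Nonempty X × fromℕ ∣ X ∣ ≤ fromℕ C * K ^ℚ C × A ⊆ p ·R +ˢ X)
    few t≤ = cosetReps A-nonempty , cosetReps-nonempty A-nonempty , (begin
      fromℕ ∣ cosetReps A-nonempty ∣
        ≤⟨ power-bound 1≤K {L} {∣ cosetReps A-nonempty ∣} {c} {e} {1} L≤2K (ℕ.≤-trans (∣cosetReps∣≤ A-nonempty)
             (ℕ.≤-trans t≤ (ℕ.≤-reflexive (trans (covering L) (sym (ℕ.*-identityʳ (c ℕ.* L ^ e))))))) ⟩
      fromℕ (c ℕ.* 2 ^ e) * K ^ℚ e * 1ℚ   ≡⟨ ℚ.*-identityʳ _ ⟩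
      fromℕ (c ℕ.* 2 ^ e) * K ^ℚ e
        ≤⟨ *-mono-≤-nonNeg {{fromℕ-nonNeg C}} {{^ℚ-nonNeg K {{K≥0}} e}} (fromℕ-mono c2^e≤C) (^ℚ-monoʳ 1≤K e≤C) ⟩
      fromℕ C * K ^ℚ C                   ∎) , A⊆p·R+cosetReps A-nonempty
    dense : p ^ k ℕ.≤ 4 ℕ.* dilateGrowth L ℕ.* ∣ A ∣ →
      inverse K 1≤K ^ℚ m * fromℕ ∣ ⊤ {p ^ k} ∣ ≤ fromℕ (d ℕ.* 2 ^ m) * fromℕ ∣ A ∣
    dense N≤ = divide-power 1≤K {fromℕ ∣ ⊤ {p ^ k} ∣} {fromℕ ∣ A ∣} {fromℕ (d ℕ.* 2 ^ m)} m (subst (λ N → fromℕ N ≤ fromℕ (d ℕ.* 2 ^ m) * K ^ℚ m * fromℕ ∣ A ∣)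
      (sym (∣⊤∣≡n (p ^ k)))
      (power-bound 1≤K {L} {p ^ k} {d} {m} {∣ A ∣} L≤2K
        (ℕ.≤-trans N≤ (ℕ.≤-reflexive (cong (ℕ._* ∣ A ∣) (density L))))))

-- Places the exponent of the covering bound below `C`, which has `2 ^ exponent` as a factor.
n≤2^n : ∀ n → n ℕ.≤ 2 ^ n
n≤2^n zero = z≤n
n≤2^n (suc n) = begin
  suc n                ≡⟨ ℕ.+-comm 1 n ⟩
  n ℕ.+ 1              ≤⟨ ℕ.+-mono-≤ (n≤2^n n) (ℕ.m^n>0 2 n) ⟩
  2 ^ n ℕ.+ 2 ^ n      ≡⟨ cong (2 ^ n ℕ.+_) (sym (ℕ.+-identityʳ (2 ^ n))) ⟩
  2 ^ suc n            ∎
  where open ℕ.≤-Reasoning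

theorem5p6 : ∃[ C ] ∃[ m ] ∃[ D ]
    ((p k : ℕ) → Prime p → 1 ℕ.≤ k →
    (A : Subset (p ^ k)) → Nonempty A →
    (K : ℚ) (1≤K : 1ℚ ≤ K) →
    fromℕ ∣ A +ˢ A ∣ ≤ K * fromℕ ∣ A ∣ →
    fromℕ ∣ A *ˢ A ∣ ≤ K * fromℕ ∣ A ∣ →
    (∃[ X ] (Nonempty X × fromℕ ∣ X ∣ ≤ fromℕ C * K ^ℚ C × A ⊆ p ·R +ˢ X))
    ⊎ inverse K 1≤K ^ℚ m * fromℕ ∣ ⊤ {p ^ k} ∣ ≤ fromℕ D * fromℕ ∣ A ∣)
theorem5p6 = scale ℕ.* 2 ^ exponent , dilateExponent , 4 ℕ.* dilateScale ℕ.* 2 ^ dilateExponent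
  , bounded-covering⊎dense {scale} {4 ℕ.* dilateScale} {exponent} {dilateExponent} (λ L → trans (cong (256 ℕ.* (L ℕ.* L ℕ.* L) ℕ.*_) (dilateGrowth-formula L)) (collect 256 dilateScale L (L ^ dilateExponent)))
      (λ L → trans (cong (4 ℕ.*_) (dilateGrowth-formula L)) (sym (ℕ.*-assoc 4 dilateScale (L ^ dilateExponent))))
      ℕ.≤-refl
      (ℕ.≤-trans (n≤2^n exponent) (ℕ.m≤n*m (2 ^ exponent) scale {{ℕ.m*n≢0 256 dilateScale {{_}} {{dilateScale≢0}}}}))
  where
  scale exponent : ℕ
  scale = 256 ℕ.* dilateScale
  -- The 3 comes from the cube of `L` that multiplies `dilateGrowth L` in the bound on residues.
  exponent = 3 ℕ.+ dilateExponent
  collect : ∀ a b l x → a ℕ.* (l ℕ.* l ℕ.* l) ℕ.* (b ℕ.* x) ≡ a ℕ.* b ℕ.* (l ℕ.* (l ℕ.* (l ℕ.* x)))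
  collect = solve-∀
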